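{- Algorithm 1 (the dynamic program specified in the context, with the sets $\mathcal{F}_{G,j}$ defined there for AdsSched) solves the AdsSched problem with $k$ clients, $n$ time points, per-time capacity $l$ and diversity parameter $\omega$ optimally, in time $O(n\,k^{l}\,\omega^{k})$.
   Context: **AdsSched.** A company manages advertisements from $k$ clients ($k$ a constant independent of $n$) over $n$ discrete time points. At each time point the advertisements of some given subset of clients are available. At most $l$ advertisements can be aired at each time point, and a diversity policy with parameter $\omega$ limits repeated airing of the same client: in any $\omega$ consecutive time points at most one advertisement of each client may be aired. The goal is to schedule the airings subject to these constraints so as to maximize the number of advertisements aired. An instance is encoded by an array $G$ with rows $1,\dots,k$ (clients) and columns $-(\omega-1),\dots,n$, where for $1\le j\le n$ we have $G[i,j]=1$ if an advertisement of client $i$ is available at time $j$ and $G[i,j]=0$ otherwise, and all columns $j\le 0$ are zero. **Notation.** $A[j_1:j_2]$ is the sub-array of columns $j_1,\dots,j_2$ of $A$, and $A[j]$ is column $j$. $A_1\le_a A_2$ means entrywise $\le$. $A_1\vDash A_2$ means that $A_1$ without its first column equals $A_2$ without its last column. For each $j$, $\mathcal{F}_{G,j}$ is the set of $k\times\omega$ arrays $W$ of zeros and ones such that (i) $W\le_a G[j-\omega+1:j]$; (ii) $W$ contains at most one non-zero element in each row; (iii) $W$ contains at most $l$ non-zero elements in each column. **Algorithm 1.** 1. Initialisation: set $\mathrm{MIS}[0,\vec 0]=0$, where $\vec 0$ is the all-zero $k\times\omega$ array; set $\mathrm{MIS}[j,W]=0$ for all $j=1,\dots,n$ and all feasible $W$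 ($0/1$ arrays of size $k\times\omega$ satisfying (ii) and (iii)). 2. For $j=1,\dots,n$ and for each $W\in\mathcal{F}_{G,j}$: let $W^*\in\mathcal{F}_{G,j-1}$ with $W^*\vDash W$ maximize $\mathrm{MIS}[j-1,W^*]$; set $\mathrm{MIS}[j,W]=\langle W[\omega],G[j]\rangle+\mathrm{MIS}[j-1,W^*]$, where $\langle\cdot,\cdot\rangle$ is the sum of products of corresponding entries of the last column $W[\omega]$ of $W$ and column $j$ of $G$; set $\mathrm{pred}[j,W]=W^*$. 3. Retrieval: find $W^*\in\mathcal{F}_{G,n}$ maximizing $\mathrm{MIS}[n,W^*]$ and let $I$ be the rightmost column of $W^*$. For $j=n$ down to $2$: replace $W^*$ by $\mathrm{pred}[j,W^*]$, then redefine $I$ as the rightmost column of this new $W^*$ concatenated with $I$. Return $I$, a $k\times n$ array whose non-zero entries mark the aired advertisements. -}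

module Defs where

open import Data.Bool using (Bool; true; false; not; if_then_else_)
import Data.Bool as Bool
open import Data.Fin using (Fin; toℕ; fromℕ<)
import Data.Fin as Fin
open import Data.Fin.Subset using (∣_∣)
open import Data.Integer using (ℤ; +_; 1ℤ)
import Data.Integer as ℤ
open import Data.List using (List; []; _∷_; length; foldr; allFin)
open import Data.List.Properties using (≡-dec)
open import Data.Nat using (ℕ; zero; suc; _+_; _*_; _∸_; _≤_; _<_; _≡ᵇ_; _≤ᵇ_; _<?_)
import Data.Nat as ℕ
open import Data.Product using (Σ-syntax; _×_; _,_)
open import Data.Vec using (Vec; []; _∷_; lookup; tabulate; map; zipWith; replicate; sum; tail; init; last; _∷ʳ_; toList)
open import Relation.Nullary using (¬_; Dec; yes; no; does)
open import Relation.Nullary.Decidable using (map′; _×-dec_)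
open import Relation.Binary.PropositionalEquality using (_≡_; refl; cong)

------------------------------------------------------------------------
-- 0/1 arrays

-- `true` is the entry 1.  By rows: `lookup A i` is row i.
Array : ℕ → ℕ → Set
Array r c = Vec (Vec Bool c) r

bit : Bool → ℕ
bit b = if b then 1 else 0

_[_,_] : ∀ {r c} → Array r c → Fin r → Fin c → Bool
A [ i , p ] = lookup (lookup A i) p

column : ∀ {r c} → Array r c → Fin c → Vec Bool r
column A p = map (λ row → lookup row p) A

infix 4 _≤ₐ_ _⊨_

_≤ₐ_ : ∀ {r c} → Array r c → Array r c → Set
A ≤ₐ B = ∀ i p → A [ i , p ] Bool.≤ B [ i , p ]

_⊨_ : ∀ {r c} → Array r (suc c) → Array r (suc c) → Set
A ⊨ B = map tail A ≡ map init B

𝟎 : ∀ {r c} → Array r c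
𝟎 = replicate _ (replicate _ false)

⟨_,_⟩ : ∀ {r} → Vec Bool r → Vec Bool r → ℕ
⟨ u , v ⟩ = sum (zipWith (λ a b → bit a * bit b) u v)

-- The time points 1 … n are the integers; every other column of a k × n
-- array is read as zero.  In particular this supplies the zero columns
-- -(ω-1) … 0 of G.
entry : ∀ {n} → Vec Bool n → ℤ → Bool
entry {n} row (+ suc t) with t <? n
... | yes t<n = lookup row (fromℕ< t<n)
... | no  _   = false
entry row _ = false

columnAt : ∀ {r n} → Array r n → ℤ → Vec Bool r
columnAt A j = map (λ row → entry row j) A

-- The m columns a, a+1, …, a+m-1 of A.
slice : ∀ {r n} → Array r n → ℤ → (m : ℕ) → Array r m
slice A a m = map (λ row → tabulate (λ p → entry row (a ℤ.+ + toℕ p))) A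

------------------------------------------------------------------------
-- The problem AdsSched

-- A window of ω consecutive time points may overlap the horizon 1 … n only
-- in part, so that the diversity policy also has content when n < ω.
record Schedule {k n} (G : Array k n) (l ω : ℕ) (A : Array k n) : Set where
  field
    available : A ≤ₐ G
    capacity  : ∀ t → ∣ column A t ∣ ≤ l
    diversity : ∀ i (a : ℤ) → ∣ lookup (slice A a ω) i ∣ ≤ 1

aired : ∀ {k n} → Array k n → ℕ
aired A = sum (map ∣_∣ A)

Optimal : ∀ {k n} → Array k n → (l ω : ℕ) → Array k n → Set
Optimal G l ω A = Schedule G l ω A × (∀ B → Schedule G l ω B → aired B ≤ aired A)

------------------------------------------------------------------------
-- The dynamic program, with every maximizer left to an arbitrary choice

Maximizes : {X : Set} → (X → Set) → (X → ℕ) → X → Set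
Maximizes P f x = P x × (∀ y → P y → f y ≤ f x)

Feasible : ∀ {k ω} → ℕ → Array k ω → Set
Feasible l W = (∀ i → ∣ lookup W i ∣ ≤ 1) × (∀ p → ∣ column W p ∣ ≤ l)

𝓕 : ∀ {k n ω} → Array k n → (l j : ℕ) → Array k ω → Set
𝓕 {ω = ω} G l j W = W ≤ₐ slice G (+ j ℤ.- + ω ℤ.+ 1ℤ) ω × Feasible l W

module _ {k n : ℕ} (G : Array k n) (l ω-1 : ℕ) where

  private
    Window : Set
    Window = Array k (suc ω-1)

  -- The tables after the forward pass.
  record Tables : Set where
    field
      MIS     : ℕ → Window → ℕ
      pred    : ℕ → Window → Window
      base    : MIS 0 𝟎 ≡ 0
      skipped : ∀ j → j < n → ∀ W → Feasible l W → ¬ 𝓕 G l (suc j) W →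
                MIS (suc j) W ≡ 0
      choice  : ∀ j → j < n → ∀ W → 𝓕 G l (suc j) W →
                Maximizes (λ V → 𝓕 G l j V × V ⊨ W) (MIS j) (pred (suc j) W)
      update  : ∀ j → j < n → ∀ W → 𝓕 G l (suc j) W →
                MIS (suc j) W ≡ ⟨ map last W , columnAt G (+ suc j) ⟩ + MIS j (pred (suc j) W)

  retrieve : (ℕ → Window → Window) → (j : ℕ) → Window → Array k j
  retrieve pred zero    W = replicate k []
  retrieve pred (suc j) W = zipWith _∷ʳ_ (retrieve pred j (pred (suc j) W)) (map last W)

  -- I is a possible result of the dynamic program.
  Returns : Array k n → Set
  Returns I = Σ[ T ∈ Tables ] Σ[ W ∈ Window ]
    Maximizes (𝓕 G l n) (Tables.MIS T n) W × I ≡ retrieve (Tables.pred T) n W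

------------------------------------------------------------------------
-- A random access machine with unit-cost words

-- One array per row of G, pred and I: the number k of rows is a constant of
-- the program.
data Name (k : ℕ) : Set where
  G[_]    : Fin k → Name k
  MIS     : Name k
  pred[_] : Fin k → Name k
  I[_]    : Fin k → Name k

_≟ₙ_ : ∀ {k} (x y : Name k) → Dec (x ≡ y)
G[ i ]    ≟ₙ G[ j ]    = map′ (cong G[_]) (λ { refl → refl }) (i Fin.≟ j)
G[ _ ]    ≟ₙ MIS       = no λ ()
G[ _ ]    ≟ₙ pred[ _ ] = no λ ()
G[ _ ]    ≟ₙ I[ _ ]    = no λ ()
MIS       ≟ₙ G[ _ ]    = no λ ()
MIS       ≟ₙ MIS       = yes refl
MIS       ≟ₙ pred[ _ ] = no λ ()
MIS       ≟ₙ I[ _ ]    = no λ ()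
pred[ _ ] ≟ₙ G[ _ ]    = no λ ()
pred[ _ ] ≟ₙ MIS       = no λ ()
pred[ i ] ≟ₙ pred[ j ] = map′ (cong pred[_]) (λ { refl → refl }) (i Fin.≟ j)
pred[ _ ] ≟ₙ I[ _ ]    = no λ ()
I[ _ ]    ≟ₙ G[ _ ]    = no λ ()
I[ _ ]    ≟ₙ MIS       = no λ ()
I[ _ ]    ≟ₙ pred[ _ ] = no λ ()
I[ i ]    ≟ₙ I[ j ]    = map′ (cong I[_]) (λ { refl → refl }) (i Fin.≟ j)

-- Programs returning r words.  V is the type of words: a program that is
-- polymorphic in V can compute with words only through these instructions,
-- so no work depending on the values of words escapes the step count.
data Prog (V : Set) (k : ℕ) : ℕ → Set where
  ret   : ∀ {r} → Vec V r → Prog V k r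
  bind  : ∀ {q r} → Prog V k q → (Vec V q → Prog V k r) → Prog V k r
  lit   : ∀ {r} → ℕ → (V → Prog V k r) → Prog V k r
  add   : ∀ {r} → V → V → (V → Prog V k r) → Prog V k r
  sub   : ∀ {r} → V → V → (V → Prog V k r) → Prog V k r
  if≡   : ∀ {r} → V → V → Prog V k r → Prog V k r → Prog V k r
  if≤   : ∀ {r} → V → V → Prog V k r → Prog V k r → Prog V k r
  read  : ∀ {r} → Name k → List V → (V → Prog V k r) → Prog V k r
  write : ∀ {r} → Name k → List V → V → Prog V k r → Prog V k r
  -- `for b xs body` runs the body for the indices 0, 1, …, b-1; the q words
  -- xs are passed from each iteration to the next and finally returned.
  for   : ∀ {q} → V → Vec V q → (V → Vec V q → Prog V k q) → Prog V k q

Store : ℕ → Set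
Store k = Name k → List ℕ → ℕ

_[_,_]≔_ : ∀ {k} → Store k → Name k → List ℕ → ℕ → Store k
(s [ x , is ]≔ v) y js =
  if does ((x ≟ₙ y) ×-dec ≡-dec ℕ._≟_ is js) then v else s y js

record Outcome (k r : ℕ) : Set where
  constructor outcome
  field
    words : Vec ℕ r
    store : Store k
    steps : ℕ

charge : ∀ {k r} → ℕ → Outcome k r → Outcome k r
charge c (outcome xs s t) = outcome xs s (c + t)

iterate : {X : Set} → ℕ → (ℕ → X → X) → X → X
iterate zero    f x = x
iterate (suc b) f x = f b (iterate b f x)

run : ∀ {k r} → Prog ℕ k r → Store k → Outcome k r
run {r = r} (ret xs) s = outcome xs s (suc r)
run (bind p c) s with run p s
... | outcome xs s′ t = charge (suc t) (run (c xs) s′)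
run (lit m c)        s = charge 1 (run (c m) s)
run (add x y c)      s = charge 1 (run (c (x + y)) s)
run (sub x y c)      s = charge 1 (run (c (x ∸ y)) s)
run (if≡ x y p q)    s = charge 1 (if x ≡ᵇ y then run p s else run q s)
run (if≤ x y p q)    s = charge 1 (if x ≤ᵇ y then run p s else run q s)
run (read a is c)    s = charge (suc (length is)) (run (c (s a is)) s)
run (write a is v p) s = charge (suc (length is)) (run p (s [ a , is ]≔ v))
run (for b xs body)  s =
  iterate b (λ { i (outcome ys s′ t) → charge (suc t) (run (body i ys) s′) })
    (outcome xs s 1)

------------------------------------------------------------------------
-- The dynamic program on this machine

-- A k × ω array with at most one non-zero element in each row is held in k
-- words: for each row the position 1 … ω of its non-zero element, or 0 if
-- there is none.
module Program {V : Set} {k : ℕ} (n l ω 0# 1# : V) where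

  private
    P : ℕ → Set
    P = Prog V k

  rows : ∀ {r} → (Fin k → P r → P r) → P r → P r
  rows f p = foldr f p (allFin k)

  sumRows : (Fin k → P 1) → P 1
  sumRows f = rows (λ i rest → bind rest λ { (x ∷ []) → bind (f i) λ { (y ∷ []) →
                add x y λ z → ret (z ∷ []) } })
              (ret (0# ∷ []))

  forVec : ∀ {q} (m : ℕ) → V → Vec V q → (Vec V m → Vec V q → P q) → P q
  forVec zero    b xs body = body [] xs
  forVec (suc m) b xs body = for b xs λ p ys → forVec m b ys λ ps → body (p ∷ ps)

  forWindows : ∀ {q} → Vec V q → (Vec V k → Vec V q → P q) → P q
  forWindows xs body = add ω 1# λ b → forVec k b xs body

  ifFeasible : ∀ {r} → Vec V k → P r → P r → P r
  ifFeasible W accept reject = rows (λ i next →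
      if≡ (lookup W i) 0# next
        (bind (sumRows λ i′ → if≡ (lookup W i′) (lookup W i) (ret (1# ∷ [])) (ret (0# ∷ [])))
         λ { (c ∷ []) → if≤ c l next reject }))
    accept

  -- Column j of G is stored at index j + ω, hence column j - ω + p at j + p.
  if𝓕 : ∀ {r} → V → Vec V k → P r → P r → P r
  if𝓕 j W accept reject = rows (λ i next →
      if≡ (lookup W i) 0# next
        (add j (lookup W i) λ c → read G[ i ] (c ∷ []) λ g → if≡ g 0# reject next))
    (ifFeasible W accept reject)

  inner : V → Vec V k → P 1
  inner j W = sumRows λ i →
    if≡ (lookup W i) ω
      (add j ω λ c → read G[ i ] (c ∷ []) λ g → ret (g ∷ []))
      (ret (0# ∷ []))

  -- The array W* with W* ⊨ W; `bs` supplies its first column in the rows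
  -- where W is zero outside its last column.
  before : ∀ {m} → Vec V m → Vec V m → P m
  before []       []       = ret []
  before (p ∷ ps) (b ∷ bs) = bind (before ps bs) λ qs →
    if≡ p 0# (ret (b ∷ qs))
      (if≡ p ω (ret (b ∷ qs))
        (add p 1# λ q → ret (q ∷ qs)))

  -- Running maximum of MIS[j,·]: a flag telling whether there has been a
  -- candidate, the best value, the best window.
  none : Vec V (2 + k)
  none = 0# ∷ 0# ∷ replicate k 0#

  improve : V → Vec V k → Vec V (2 + k) → P (2 + k)
  improve j W (found ∷ best ∷ W*) =
    read MIS (j ∷ toList W) λ v →
    if≡ found 0# (ret (1# ∷ v ∷ W))
      (if≤ v best (ret (found ∷ best ∷ W*)) (ret (1# ∷ v ∷ W)))

  initialise : P 0
  initialise =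
    write MIS (0# ∷ toList (replicate k 0#)) 0#
    (for n [] λ i _ → add i 1# λ j →
      forWindows [] λ W _ →
        ifFeasible W (write MIS (j ∷ toList W) 0# (ret [])) (ret []))

  forward : P 0
  forward =
    for n [] λ i _ → add i 1# λ j →
      forWindows [] λ W _ →
        if𝓕 j W
          (bind (add 1# 1# λ b → forVec k b none λ bs best →
                   bind (before W bs) λ W* → if𝓕 i W* (improve i W* best) (ret best))
           λ { (_ ∷ v ∷ W*) →
             bind (inner j W) λ { (g ∷ []) →
             add g v λ m →
             write MIS (j ∷ toList W) m
             (rows (λ a → write pred[ a ] (j ∷ toList W) (lookup W* a)) (ret [])) } })
          (ret [])

  readPred : V → Vec V k → P k
  readPred j W = go (λ i → i)
    where
    go : ∀ {m} → (Fin m → Fin k) → P m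
    go {zero}  f = ret []
    go {suc m} f = read pred[ f Fin.zero ] (j ∷ toList W) λ p →
                   bind (go (λ i → f (Fin.suc i))) λ ps → ret (p ∷ ps)

  writeColumn : V → Vec V k → P 0
  writeColumn j W = rows (λ i next →
      if≡ (lookup W i) ω (write I[ i ] (j ∷ []) 1# next) (write I[ i ] (j ∷ []) 0# next))
    (ret [])

  retrieval : P k
  retrieval =
    bind (forWindows none λ W best → if𝓕 n W (improve n W best) (ret best))
    λ { (_ ∷ _ ∷ W*) →
      bind (writeColumn n W*) λ _ →
      sub n 1# λ b →
      for b W* λ i W → sub n i λ j →
        bind (readPred j W) λ W′ →
        sub j 1# λ j′ →
        bind (writeColumn j′ W′) λ _ → ret W′ }

algorithm1 : (k : ℕ) {V : Set} (n l ω : V) → Prog V k k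
algorithm1 k n l ω =
  lit 0 λ 0# → lit 1 λ 1# →
  let open Program {k = k} n l ω 0# 1# in
  bind initialise λ _ → bind forward λ _ → retrieval

-- The store initially contains the columns -(ω-1) … n of G, column j at index
-- j + ω, and arbitrary values everywhere else.
Loaded : ∀ {k n} → Array k n → (ω : ℕ) → Store k → Set
Loaded {k} {n} G ω s = ∀ (i : Fin k) c → 1 ≤ c → c ≤ n + ω →
  s G[ i ] (c ∷ []) ≡ bit (entry (lookup G i) (+ c ℤ.- + ω))

result : ∀ k n → Store k → Array k n
result k n s = tabulate λ i → tabulate λ t → not (s I[ i ] (suc (toℕ t) ∷ []) ≡ᵇ 0)

{-# OPTIONS --safe #-}

-- A 0/1 array is a schedule exactly when each of its windows of ω columns
-- ending at a time j ≤ n lies in 𝓕 G l j: two airings of one client less than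
-- ω apart both lie in the window that ends at the later one.  The windows of
-- a schedule form a chain for ⊨, and every chain for ⊨ from the zero array
-- consists of the windows of the array of its last columns.  Hence MIS[j,W]
-- is the largest number of airings up to time j of a schedule with last
-- window W, and following pred recovers a schedule attaining it.
--
-- On the machine, a window is determined by its k words.  The cells MIS[j,·]
-- and pred[j,·] are written only in iteration j of the forward pass, so they
-- form tables of the dynamic program when the pass ends.  The (ω+1)^k ≤ 2^k ω^k
-- windows per time point, each with at most 2^k predecessors, give the bound
-- on the number of steps.

module Submission where

open import Defs
open import Algebra.Properties.CommutativeSemigroup using (interchange)
open import Data.Bool using (Bool; true; false; not; T; if_then_else_)
import Data.Bool as Bool
open import Data.Fin using (Fin; zero; suc; toℕ; fromℕ; fromℕ<; inject₁)
import Data.Fin as Fin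
open import Data.Fin.Properties using (toℕ<n; toℕ-injective; toℕ-fromℕ<; toℕ-fromℕ; toℕ-inject₁)
open import Data.Fin.Subset using (∣_∣)
open import Data.Integer using (ℤ; +_; 1ℤ)
import Data.Integer as ℤ
import Data.Integer.Properties as ℤ
import Data.Integer.Solver as ℤ
open import Data.List using (List; []; _∷_; foldr; allFin; length)
import Data.List as List
open import Data.List.Membership.Propositional using (_∈_)
open import Data.List.Membership.Propositional.Properties using (∈-allFin)
import Data.List.Properties as List
open import Data.List.Relation.Unary.Any using (here; there)
open import Data.Nat using (ℕ; zero; suc; _+_; _*_; _∸_; _^_; _⊔_; _≤_; _<_; z≤n; s≤s; _≡ᵇ_; _≤ᵇ_; _≤?_; _<?_; NonZero; >-nonZero; >-nonZero⁻¹)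
import Data.Nat as ℕ
open import Data.Nat.Properties
import Data.Nat.Solver as ℕ
open import Data.Product using (Σ-syntax; _×_; _,_; proj₁; proj₂)
open import Data.Sum using (_⊎_; inj₁; inj₂)
open import Data.Unit using (tt)
open import Data.Vec using (Vec; []; _∷_; lookup; tabulate; map; zipWith; replicate; sum; tail; init; last; initLast; _∷ʳ_; toList)
open import Data.Vec.Properties using (lookup∘tabulate; tabulate∘lookup; tabulate-cong; lookup-map; lookup-zipWith; lookup-replicate; ≡-dec; toList-injective; cast-is-id; length-toList)
open import Relation.Nullary using (¬_; yes; no; contradiction)
open import Relation.Nullary.Decidable using (dec-true; dec-false; _×-dec_)
open import Relation.Binary.PropositionalEquality using (_≡_; _≢_; refl; sym; trans; cong; cong₂; subst; subst₂; module ≡-Reasoning)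

-- Vectors and arrays

-- The two halves of the theorem meet in `Returns`. It admits every choice of maximizers, so
-- optimality is proved once for abstract tables, and the machine part only has to exhibit the final
-- store, read through `encode` and `decode`, as such tables. The obstacle on the machine is the
-- mutable store: what has been established for one window must survive the writes made for all
-- later ones. Each fact is therefore stated with the few cells on which it depends, and the loop
-- rules carry a clause that preserves the goals already reached. Running time is treated apart from
-- correctness and uniformly in the store. The program runs through all vectors of `k` words in 0
-- ... ω and rejects those outside `𝓕` by tests whose cost depends on `k` only. The constants are
-- left to unification; as they are chosen before `n`, `l` and `ω` are introduced, they can depend
-- on `k` alone.

lookup-ext : ∀ {a} {X : Set a} {n} {u v : Vec X n} → (∀ i → lookup u i ≡ lookup v i) → u ≡ v
lookup-ext {u = u} {v} eq = trans (sym (tabulate∘lookup u)) (trans (tabulate-cong eq) (tabulate∘lookup v))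

array-ext : ∀ {r c} {A B : Array r c} → (∀ i p → A [ i , p ] ≡ B [ i , p ]) → A ≡ B
array-ext eq = lookup-ext λ i → lookup-ext (eq i)

lookup-init : ∀ {X : Set} {n} (v : Vec X (suc n)) p → lookup (init v) p ≡ lookup v (inject₁ p)
lookup-init (x ∷ y ∷ v) zero    = refl
lookup-init (x ∷ y ∷ v) (suc p) = lookup-init (y ∷ v) p

lookup-tail : ∀ {X : Set} {n} (v : Vec X (suc n)) p → lookup (tail v) p ≡ lookup v (suc p)
lookup-tail (x ∷ v) p = refl

last-lookup : ∀ {X : Set} {n} (v : Vec X (suc n)) → last v ≡ lookup v (fromℕ n)
last-lookup (x ∷ [])    = refl
last-lookup (x ∷ y ∷ v) = last-lookup (y ∷ v)

tabulate-∷ʳ : ∀ {X : Set} n (h : ℕ → X) →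
  tabulate {n = suc n} (λ p → h (toℕ p)) ≡ tabulate {n = n} (λ p → h (toℕ p)) ∷ʳ h n
tabulate-∷ʳ zero    h = refl
tabulate-∷ʳ (suc n) h = cong (h 0 ∷_) (tabulate-∷ʳ n (λ t → h (suc t)))

-- Separates the newest column of a window from the columns that it shares with the preceding
-- window.
data Snoc {n} : Fin (suc n) → Set where
  end  : Snoc (fromℕ n)
  body : (p : Fin n) → Snoc (inject₁ p)

snoc : ∀ {n} (p : Fin (suc n)) → Snoc p
snoc {zero}  zero    = end
snoc {suc n} zero    = body zero
snoc {suc n} (suc p) with snoc p
... | end    = end
... | body q = body (suc q)

⊨⇒shift : ∀ {r c} {A B : Array r (suc c)} → A ⊨ B → ∀ i p → A [ i , suc p ] ≡ B [ i , inject₁ p ]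
⊨⇒shift {A = A} {B} A⊨B i p = begin
  lookup (lookup A i) (suc p)         ≡⟨ lookup-tail (lookup A i) p ⟨
  lookup (tail (lookup A i)) p        ≡⟨ cong (λ v → lookup v p) (lookup-map i tail A) ⟨
  lookup (lookup (map tail A) i) p    ≡⟨ cong (_[ i , p ]) A⊨B ⟩
  lookup (lookup (map init B) i) p    ≡⟨ cong (λ v → lookup v p) (lookup-map i init B) ⟩
  lookup (init (lookup B i)) p        ≡⟨ lookup-init (lookup B i) p ⟩
  lookup (lookup B i) (inject₁ p)     ∎
  where open ≡-Reasoning

shift⇒⊨ : ∀ {r c} {A B : Array r (suc c)} → (∀ i p → A [ i , suc p ] ≡ B [ i , inject₁ p ]) → A ⊨ B
shift⇒⊨ {A = A} {B} eq = array-ext λ i p → begin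
  lookup (lookup (map tail A) i) p    ≡⟨ cong (λ v → lookup v p) (lookup-map i tail A) ⟩
  lookup (tail (lookup A i)) p        ≡⟨ lookup-tail (lookup A i) p ⟩
  lookup (lookup A i) (suc p)         ≡⟨ eq i p ⟩
  lookup (lookup B i) (inject₁ p)     ≡⟨ lookup-init (lookup B i) p ⟨
  lookup (init (lookup B i)) p        ≡⟨ cong (λ v → lookup v p) (lookup-map i init B) ⟨
  lookup (lookup (map init B) i) p    ∎
  where open ≡-Reasoning

𝟎-false : ∀ {r c} i p → 𝟎 {r} {c} [ i , p ] ≡ false
𝟎-false {r} {c} i p rewrite lookup-replicate {n = r} i (replicate c false) = lookup-replicate p false

≤-true : ∀ {a b} → a Bool.≤ b → a ≡ true → b ≡ true
≤-true Bool.b≤b a = a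

true-≤ : ∀ {a b} → (a ≡ true → b ≡ true) → a Bool.≤ b
true-≤ {false} {false} _ = Bool.b≤b
true-≤ {false} {true}  _ = Bool.f≤t
true-≤ {true}  f with refl ← f refl = Bool.b≤b

≤-false : ∀ {a b} → a Bool.≤ b → b ≡ false → a ≡ false
≤-false Bool.b≤b b = b

false-≤ : ∀ {a b} → a ≡ false → a Bool.≤ b
false-≤ refl = true-≤ λ ()

∣∷∣ : ∀ {n} b (v : Vec Bool n) → ∣ b ∷ v ∣ ≡ bit b + ∣ v ∣
∣∷∣ true  v = refl
∣∷∣ false v = refl

∣∷ʳ∣ : ∀ {n} (v : Vec Bool n) b → ∣ v ∷ʳ b ∣ ≡ ∣ v ∣ + bit b
∣∷ʳ∣ []      true  = refl
∣∷ʳ∣ []      false = refl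
∣∷ʳ∣ (true ∷ v)  b = cong suc (∣∷ʳ∣ v b)
∣∷ʳ∣ (false ∷ v) b = ∣∷ʳ∣ v b

none⇒∣∣≡0 : ∀ {n} (v : Vec Bool n) → (∀ p → lookup v p ≡ false) → ∣ v ∣ ≡ 0
none⇒∣∣≡0 []          _ = refl
none⇒∣∣≡0 (true ∷ v)  f = contradiction (f zero) λ ()
none⇒∣∣≡0 (false ∷ v) f = none⇒∣∣≡0 v λ p → f (suc p)

∣∣≡0⇒none : ∀ {n} (v : Vec Bool n) → ∣ v ∣ ≤ 0 → ∀ p → lookup v p ≡ false
∣∣≡0⇒none (false ∷ v) _ zero    = refl
∣∣≡0⇒none (false ∷ v) h (suc p) = ∣∣≡0⇒none v h p

Unique : ∀ {n} → Vec Bool n → Set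
Unique v = ∀ p q → lookup v p ≡ true → lookup v q ≡ true → p ≡ q

∣∣≤1⇒unique : ∀ {n} (v : Vec Bool n) → ∣ v ∣ ≤ 1 → Unique v
∣∣≤1⇒unique (true ∷ v)  h zero    zero    _ _  = refl
∣∣≤1⇒unique (true ∷ v)  (s≤s h) zero    (suc q) _ vq = contradiction (trans (sym vq) (∣∣≡0⇒none v h q)) λ ()
∣∣≤1⇒unique (true ∷ v)  (s≤s h) (suc p) _       vp _ = contradiction (trans (sym vp) (∣∣≡0⇒none v h p)) λ ()
∣∣≤1⇒unique (false ∷ v) h (suc p) (suc q) vp vq = cong suc (∣∣≤1⇒unique v h p q vp vq)

unique⇒∣∣≤1 : ∀ {n} (v : Vec Bool n) → Unique v → ∣ v ∣ ≤ 1
unique⇒∣∣≤1 []          _ = z≤n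
unique⇒∣∣≤1 (true ∷ v)  u = s≤s (≤-reflexive (none⇒∣∣≡0 v rest))
  where
  rest : ∀ p → lookup v p ≡ false
  rest p with lookup v p in eq
  ... | false = refl
  ... | true  = contradiction (u zero (suc p) refl eq) λ ()
unique⇒∣∣≤1 (false ∷ v) u = unique⇒∣∣≤1 v λ p q vp vq → suc-inj (u (suc p) (suc q) vp vq)
  where
  suc-inj : ∀ {n} {p q : Fin n} → suc p ≡ suc q → p ≡ q
  suc-inj refl = refl

-- Each airing in `u` meets a 1 in `v`. Hence the product in the update of `MIS` counts exactly the
-- airings in the new column.
⟨,⟩-≤ : ∀ {r} (u v : Vec Bool r) → (∀ i → lookup u i Bool.≤ lookup v i) → ⟨ u , v ⟩ ≡ ∣ u ∣
⟨,⟩-≤ []      []      _ = refl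
⟨,⟩-≤ (true ∷ u)  (b ∷ v) u≤v rewrite ≤-true (u≤v zero) refl = cong suc (⟨,⟩-≤ u v λ i → u≤v (suc i))
⟨,⟩-≤ (false ∷ u) (b ∷ v) u≤v = ⟨,⟩-≤ u v λ i → u≤v (suc i)

aired-∷ʳ : ∀ {r c} (A : Array r c) (u : Vec Bool r) → aired (zipWith _∷ʳ_ A u) ≡ aired A + ∣ u ∣
aired-∷ʳ []      []      = refl
aired-∷ʳ (v ∷ A) (b ∷ u) rewrite ∣∷ʳ∣ v b | aired-∷ʳ A u | ∣∷∣ b u = interchange +-commutativeSemigroup (∣ v ∣) (bit b) (aired A) (∣ u ∣)

-- Entries at time points

-- Index t stands for the time point t + 1.
at : ∀ {n} → Vec Bool n → ℕ → Bool
at []      _       = false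
at (b ∷ v) zero    = b
at (b ∷ v) (suc t) = at v t

at-lookup : ∀ {n} (v : Vec Bool n) p → at v (toℕ p) ≡ lookup v p
at-lookup (b ∷ v) zero    = refl
at-lookup (b ∷ v) (suc p) = at-lookup v p

at-≥ : ∀ {n} (v : Vec Bool n) {t} → n ≤ t → at v t ≡ false
at-≥ []      _         = refl
at-≥ (b ∷ v) (s≤s n≤t) = at-≥ v n≤t

at-true⇒< : ∀ {n} (v : Vec Bool n) {t} → at v t ≡ true → t < n
at-true⇒< (b ∷ v) {zero}  _ = s≤s z≤n
at-true⇒< (b ∷ v) {suc t} h = s≤s (at-true⇒< v h)

at-∷ʳ-< : ∀ {n} (v : Vec Bool n) b {t} → t < n → at (v ∷ʳ b) t ≡ at v t
at-∷ʳ-< (x ∷ v) b {zero}  _         = refl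
at-∷ʳ-< (x ∷ v) b {suc t} (s≤s t<n) = at-∷ʳ-< v b t<n

at-∷ʳ-≡ : ∀ {n} (v : Vec Bool n) b → at (v ∷ʳ b) n ≡ b
at-∷ʳ-≡ []      b = refl
at-∷ʳ-≡ (x ∷ v) b = at-∷ʳ-≡ v b

entry-at : ∀ {n} (v : Vec Bool n) t → entry v (+ suc t) ≡ at v t
entry-at {n} v t with t <? n
... | yes t<n = trans (sym (at-lookup v (fromℕ< t<n))) (cong (at v) (toℕ-fromℕ< t<n))
... | no  t≮n = sym (at-≥ v (≮⇒≥ t≮n))

entry-true : ∀ {n} (v : Vec Bool n) z → entry v z ≡ true → Σ[ t ∈ ℕ ] (z ≡ + suc t × at v t ≡ true)
entry-true v (+ suc t) h = t , refl , trans (sym (entry-at v t)) h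

-- c is an index of the machine's arrays G[_], which hold column j at index j + ω.
padded : ∀ {n} → ℕ → Vec Bool n → ℕ → Bool
padded ω v c = entry v (+ c ℤ.- + ω)

-- The time point is the negative of `ω ∸ c`, hence 0 or a negative integer; both fall into the
-- default clause of `entry`.
padded-≤ : ∀ {n} ω (v : Vec Bool n) {c} → c ≤ ω → padded ω v c ≡ false
padded-≤ ω v {c} c≤ω rewrite ℤ.m-n≡m⊖n c ω | ℤ.⊖-≤ c≤ω with ω ∸ c
... | zero  = refl
... | suc _ = refl

padded-at : ∀ {n} ω (v : Vec Bool n) t → padded ω v (ω + suc t) ≡ at v t
padded-at ω v t rewrite ℤ.m-n≡m⊖n (ω + suc t) ω | ℤ.⊖-≥ (m≤m+n ω (suc t)) | m+n∸m≡n ω (suc t) = entry-at v t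

data PaddedIndex (ω c : ℕ) : Set where
  before-start : c ≤ ω → PaddedIndex ω c
  time         : ∀ t → c ≡ ω + suc t → PaddedIndex ω c

paddedIndex : ∀ ω c → PaddedIndex ω c
paddedIndex ω c with c ≤? ω
... | yes c≤ω = before-start c≤ω
... | no  c≰ω = time (c ∸ suc ω) (sym (trans (+-suc ω _) (m+[n∸m]≡n (≰⇒> c≰ω))))

window-start : ℕ → ℕ → ℤ
window-start ω j = + j ℤ.- + ω ℤ.+ 1ℤ

window-time : ∀ ω j p → window-start ω j ℤ.+ + p ≡ + (j + suc p) ℤ.- + ω
window-time ω j p rewrite ℤ.pos-+ j (suc p) | ℤ.pos-+ 1 p =
  solve 3 (λ x y z → x :- y :+ con 1ℤ :+ z := x :+ (con 1ℤ :+ z) :- y) refl (+ j) (+ ω) (+ p)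
  where open ℤ.+-*-Solver

lookup-slice : ∀ {r n} (A : Array r n) a m i p → slice A a m [ i , p ] ≡ entry (lookup A i) (a ℤ.+ + toℕ p)
lookup-slice A a m i p rewrite lookup-map i (λ row → tabulate {n = m} (λ q → entry row (a ℤ.+ + toℕ q))) A =
  lookup∘tabulate _ p

window : ∀ {r n} → Array r n → (ω j : ℕ) → Array r ω
window A ω j = slice A (window-start ω j) ω

-- Turns integer time points into the machine's natural indices. Moving one position to the right
-- and letting the window end one step later then have the same effect on the index.
lookup-window : ∀ {r n} (A : Array r n) ω j i p → window A ω j [ i , p ] ≡ padded ω (lookup A i) (j + suc (toℕ p))
lookup-window A ω j i p = trans (lookup-slice A (window-start ω j) ω i p) (cong (entry (lookup A i)) (window-time ω j (toℕ p)))

lookup-columnAt : ∀ {r n} (A : Array r n) j i → lookup (columnAt A (+ suc j)) i ≡ at (lookup A i) j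
lookup-columnAt A j i = trans (lookup-map i _ A) (entry-at (lookup A i) j)

lookup-column : ∀ {r c} (A : Array r c) p i → lookup (column A p) i ≡ A [ i , p ]
lookup-column A p i = lookup-map i _ A

lookup-window-last : ∀ {r n} (A : Array r n) w j i → window A (suc w) (suc j) [ i , fromℕ w ] ≡ at (lookup A i) j
lookup-window-last A w j i = begin
  window A (suc w) (suc j) [ i , fromℕ w ]                       ≡⟨ lookup-window A (suc w) (suc j) i (fromℕ w) ⟩
  padded (suc w) (lookup A i) (suc j + suc (toℕ (fromℕ w)))      ≡⟨ cong (λ x → padded (suc w) (lookup A i) (suc j + suc x)) (toℕ-fromℕ w) ⟩
  padded (suc w) (lookup A i) (suc j + suc w)                    ≡⟨ cong (padded (suc w) (lookup A i)) (+-comm (suc j) (suc w)) ⟩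
  padded (suc w) (lookup A i) (suc w + suc j)                    ≡⟨ padded-at (suc w) (lookup A i) j ⟩
  at (lookup A i) j                                              ∎
  where open ≡-Reasoning

last-window : ∀ {r n} (A : Array r n) w j → map last (window A (suc w) (suc j)) ≡ columnAt A (+ suc j)
last-window A w j = lookup-ext λ i → begin
  lookup (map last (window A (suc w) (suc j))) i   ≡⟨ lookup-map i last (window A (suc w) (suc j)) ⟩
  last (lookup (window A (suc w) (suc j)) i)       ≡⟨ last-lookup (lookup (window A (suc w) (suc j)) i) ⟩
  window A (suc w) (suc j) [ i , fromℕ w ]         ≡⟨ lookup-window-last A w j i ⟩
  at (lookup A i) j                                ≡⟨ lookup-columnAt A j i ⟨
  lookup (columnAt A (+ suc j)) i                  ∎
  where open ≡-Reasoning

window-⊨ : ∀ {r n} (A : Array r n) w j → window A (suc w) j ⊨ window A (suc w) (suc j)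
window-⊨ A w j = shift⇒⊨ {A = window A (suc w) j} {B = window A (suc w) (suc j)} λ i p → begin
  window A (suc w) j [ i , suc p ]                               ≡⟨ lookup-window A (suc w) j i (suc p) ⟩
  padded (suc w) (lookup A i) (j + suc (suc (toℕ p)))            ≡⟨ cong (padded (suc w) (lookup A i)) (+-suc j _) ⟩
  padded (suc w) (lookup A i) (suc j + suc (toℕ p))              ≡⟨ cong (λ x → padded (suc w) (lookup A i) (suc j + suc x)) (toℕ-inject₁ p) ⟨
  padded (suc w) (lookup A i) (suc j + suc (toℕ (inject₁ p)))    ≡⟨ lookup-window A (suc w) (suc j) i (inject₁ p) ⟨
  window A (suc w) (suc j) [ i , inject₁ p ]                     ∎
  where open ≡-Reasoning

-- Windows in 𝓕

module _ {k n : ℕ} (G : Array k n) (l : ℕ) where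

  𝓕-last : ∀ w j (W : Array k (suc w)) → 𝓕 G l (suc j) W → ∀ i → lookup (map last W) i Bool.≤ lookup (columnAt G (+ suc j)) i
  𝓕-last w j W (W≤ , _) i
    rewrite lookup-map i last W | last-lookup (lookup W i) | lookup-columnAt G j i | sym (lookup-window-last G w j i)
    = W≤ i (fromℕ w)

  -- For `j = 0` all positions lie in the zero padding of `G`, so every chain of windows has the
  -- same starting point.
  𝓕0⇒𝟎 : ∀ w (W : Array k (suc w)) → 𝓕 G l 0 W → W ≡ 𝟎
  𝓕0⇒𝟎 w W (W≤ , _) = array-ext λ i p →
    trans (≤-false (W≤ i p) (trans (lookup-window G (suc w) 0 i p) (padded-≤ (suc w) (lookup G i) (toℕ<n p))))
          (sym (𝟎-false i p))

  𝟎-feasible : ∀ {ω} → Feasible {k} {ω} l 𝟎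
  𝟎-feasible {ω} = (λ i → ≤-trans (≤-reflexive (none⇒∣∣≡0 (lookup 𝟎 i) (𝟎-false i))) z≤n)
               , (λ p → ≤-trans (≤-reflexive (none⇒∣∣≡0 (column {k} {ω} 𝟎 p) λ i → trans (lookup-column {k} {ω} 𝟎 p i) (𝟎-false i p))) z≤n)

  𝟎∈𝓕 : ∀ {ω} j → 𝓕 {ω = ω} G l j 𝟎
  𝟎∈𝓕 j = (λ i p → false-≤ (𝟎-false i p)) , 𝟎-feasible

  -- Diversity holds for every integer start, so the row condition is an instance of it. A column of
  -- the window is either a column of `B` or lies outside 1 ... n and is empty.
  schedule⇒window∈𝓕 : ∀ {w} {B : Array k n} → Schedule G l (suc w) B → ∀ j → 𝓕 G l j (window B (suc w) j)
  schedule⇒window∈𝓕 {w} {B} sch j = available′ , (λ i → diversity i (window-start ω j)) , capacity′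
    where
    open Schedule sch
    ω = suc w
    at-≤ : ∀ i t → at (lookup B i) t Bool.≤ at (lookup G i) t
    at-≤ i t with t <? n
    ... | no  t≮n = false-≤ (at-≥ (lookup B i) (≮⇒≥ t≮n))
    ... | yes t<n = subst (λ x → at (lookup B i) x Bool.≤ at (lookup G i) x) (toℕ-fromℕ< t<n)
                      (subst₂ Bool._≤_ (sym (at-lookup (lookup B i) (fromℕ< t<n))) (sym (at-lookup (lookup G i) (fromℕ< t<n)))
                        (available i (fromℕ< t<n)))
    available′ : window B ω j ≤ₐ window G ω j
    available′ i p rewrite lookup-window B ω j i p | lookup-window G ω j i p with paddedIndex ω (j + suc (toℕ p))
    ... | before-start c≤ω = false-≤ (padded-≤ ω (lookup B i) c≤ω)
    ... | time t eq rewrite eq | padded-at ω (lookup B i) t | padded-at ω (lookup G i) t = at-≤ i t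
    empty : ∀ p → (∀ i → window B ω j [ i , p ] ≡ false) → ∣ column (window B ω j) p ∣ ≤ l
    empty p f = ≤-trans (≤-reflexive (none⇒∣∣≡0 (column (window B ω j) p) λ i → trans (lookup-column (window B ω j) p i) (f i))) z≤n
    capacity′ : ∀ p → ∣ column (window B ω j) p ∣ ≤ l
    capacity′ p with paddedIndex ω (j + suc (toℕ p))
    ... | before-start c≤ω = empty p λ i → trans (lookup-window B ω j i p) (padded-≤ ω (lookup B i) c≤ω)
    ... | time t eq with t <? n
    ...   | no  t≮n = empty p λ i → trans (lookup-window B ω j i p) (trans (cong (padded ω (lookup B i)) eq)
                        (trans (padded-at ω (lookup B i) t) (at-≥ (lookup B i) (≮⇒≥ t≮n))))
    ...   | yes t<n = subst (λ u → ∣ u ∣ ≤ l) (lookup-ext {u = column B (fromℕ< t<n)} {v = column (window B ω j) p} same) (capacity (fromℕ< t<n))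
      where
      open ≡-Reasoning
      same : ∀ i → lookup (column B (fromℕ< t<n)) i ≡ lookup (column (window B ω j) p) i
      same i = begin
        lookup (column B (fromℕ< t<n)) i          ≡⟨ lookup-column B (fromℕ< t<n) i ⟩
        B [ i , fromℕ< t<n ]                      ≡⟨ at-lookup (lookup B i) (fromℕ< t<n) ⟨
        at (lookup B i) (toℕ (fromℕ< t<n))        ≡⟨ cong (at (lookup B i)) (toℕ-fromℕ< t<n) ⟩
        at (lookup B i) t                         ≡⟨ padded-at ω (lookup B i) t ⟨
        padded ω (lookup B i) (ω + suc t)         ≡⟨ cong (padded ω (lookup B i)) eq ⟨
        padded ω (lookup B i) (j + suc (toℕ p))   ≡⟨ lookup-window B ω j i p ⟨
        window B ω j [ i , p ]                    ≡⟨ lookup-column (window B ω j) p i ⟨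
        lookup (column (window B ω j) p) i        ∎

  -- Availability and capacity at a time point are read off the last column of the window that ends
  -- there. Diversity concerns arbitrary integer starts and is reduced to such windows by `apart`
  -- and `ordered`.
  windows∈𝓕⇒schedule : ∀ {w} {B : Array k n} → (∀ j → j ≤ n → 𝓕 G l j (window B (suc w) j)) → Schedule G l (suc w) B
  windows∈𝓕⇒schedule {w} {B} win = record { available = available ; capacity = capacity ; diversity = diversity }
    where
    ω = suc w
    last-entry : ∀ i (t : Fin n) → window B ω (suc (toℕ t)) [ i , fromℕ w ] ≡ B [ i , t ]
    last-entry i t = trans (lookup-window-last B w (toℕ t) i) (at-lookup (lookup B i) t)
    available : B ≤ₐ G
    available i t = subst₂ Bool._≤_ (last-entry i t) (trans (lookup-window-last G w (toℕ t) i) (at-lookup (lookup G i) t))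
      (proj₁ (win (suc (toℕ t)) (toℕ<n t)) i (fromℕ w))
    capacity : ∀ t → ∣ column B t ∣ ≤ l
    capacity t = subst (λ u → ∣ u ∣ ≤ l)
      (lookup-ext {u = column (window B ω (suc (toℕ t))) (fromℕ w)} {v = column B t} λ i → trans (lookup-column (window B ω (suc (toℕ t))) (fromℕ w) i) (trans (last-entry i t) (sym (lookup-column B t i))))
      (proj₂ (proj₂ (win (suc (toℕ t)) (toℕ<n t))) (fromℕ w))
    -- The window that ends at the later airing has the earlier one at position `w ∸ d` and the
    -- later one at position `w`. The row has at most one entry, so the positions agree.
    apart : ∀ i t d → d < ω → at (lookup B i) t ≡ true → at (lookup B i) (t + d) ≡ true → d ≡ 0
    apart i t d (s≤s d≤w) early late = begin
      d              ≡⟨ m∸[m∸n]≡n d≤w ⟨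
      w ∸ (w ∸ d)    ≡⟨ cong (w ∸_) (toℕ-fromℕ< w∸d<ω) ⟨
      w ∸ toℕ p      ≡⟨ cong (λ x → w ∸ toℕ x) p≡q ⟩
      w ∸ toℕ (fromℕ w) ≡⟨ cong (w ∸_) (toℕ-fromℕ w) ⟩
      w ∸ w          ≡⟨ n∸n≡0 w ⟩
      0              ∎
      where
      open ≡-Reasoning
      w∸d<ω : w ∸ d < ω
      w∸d<ω = s≤s (m∸n≤m w d)
      p = fromℕ< w∸d<ω
      j = suc (t + d)
      index : j + suc (w ∸ d) ≡ ω + suc t
      index = cong suc (begin
        t + d + suc (w ∸ d)   ≡⟨ +-suc (t + d) (w ∸ d) ⟩
        suc (t + d + (w ∸ d)) ≡⟨ cong suc (+-assoc t d (w ∸ d)) ⟩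
        suc (t + (d + (w ∸ d))) ≡⟨ cong (λ x → suc (t + x)) (m+[n∸m]≡n d≤w) ⟩
        suc (t + w)           ≡⟨ cong suc (+-comm t w) ⟩
        suc (w + t)           ≡⟨ +-suc w t ⟨
        w + suc t             ∎)
      at-p : window B ω j [ i , p ] ≡ true
      at-p = begin
        window B ω j [ i , p ]                     ≡⟨ lookup-window B ω j i p ⟩
        padded ω (lookup B i) (j + suc (toℕ p))    ≡⟨ cong (λ x → padded ω (lookup B i) (j + suc x)) (toℕ-fromℕ< w∸d<ω) ⟩
        padded ω (lookup B i) (j + suc (w ∸ d))    ≡⟨ cong (padded ω (lookup B i)) index ⟩
        padded ω (lookup B i) (ω + suc t)          ≡⟨ padded-at ω (lookup B i) t ⟩
        at (lookup B i) t                          ≡⟨ early ⟩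
        true                                       ∎
      p≡q : p ≡ fromℕ w
      -- The later airing is an entry of `B`, so it lies within the horizon; this is the bound
      -- `j ≤ n` that `win` asks for.
      p≡q = ∣∣≤1⇒unique (lookup (window B ω j) i) (proj₁ (proj₂ (win j (at-true⇒< (lookup B i) late))) i) p (fromℕ w) at-p
              (trans (lookup-window-last B w (t + d) i) late)
    -- A true entry sits at a positive time point, so both integer positions become natural numbers
    -- and the start `a` cancels from their difference.
    ordered : ∀ i a (p q : Fin ω) → toℕ p ≤ toℕ q → entry (lookup B i) (a ℤ.+ + toℕ p) ≡ true →
              entry (lookup B i) (a ℤ.+ + toℕ q) ≡ true → p ≡ q
    ordered i a p q p≤q hp hq with entry-true (lookup B i) (a ℤ.+ + toℕ p) hp | entry-true (lookup B i) (a ℤ.+ + toℕ q) hq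
    ... | t , at-t , ht | u , at-u , hu = toℕ-injective (≤-antisym p≤q (m∸n≡0⇒m≤n d≡0))
      where
      d = toℕ q ∸ toℕ p
      u≡t+d : u ≡ t + d
      u≡t+d = suc-injective (ℤ.+-injective (begin
        + suc u                       ≡⟨ at-u ⟨
        a ℤ.+ + toℕ q                 ≡⟨ cong (λ x → a ℤ.+ + x) (m+[n∸m]≡n p≤q) ⟨
        a ℤ.+ + (toℕ p + d)           ≡⟨ cong (λ x → a ℤ.+ x) (ℤ.pos-+ (toℕ p) d) ⟩
        a ℤ.+ (+ toℕ p ℤ.+ + d)       ≡⟨ ℤ.+-assoc a (+ toℕ p) (+ d) ⟨
        a ℤ.+ + toℕ p ℤ.+ + d         ≡⟨ cong (λ x → x ℤ.+ + d) at-t ⟩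
        + suc t ℤ.+ + d               ≡⟨ ℤ.pos-+ (suc t) d ⟨
        + suc (t + d)                 ∎))
        where open ≡-Reasoning
      d≡0 : d ≡ 0
      d≡0 = apart i t d (≤-<-trans (m∸n≤m (toℕ q) (toℕ p)) (toℕ<n q)) ht (subst (λ x → at (lookup B i) x ≡ true) u≡t+d hu)
    diversity : ∀ i a → ∣ lookup (slice B a ω) i ∣ ≤ 1
    diversity i a = unique⇒∣∣≤1 (lookup (slice B a ω) i) λ p q hp hq →
      let hp′ = trans (sym (lookup-slice B a ω i p)) hp
          hq′ = trans (sym (lookup-slice B a ω i q)) hq
      in case-total p q hp′ hq′
      where
      case-total : ∀ (p q : Fin ω) → entry (lookup B i) (a ℤ.+ + toℕ p) ≡ true → entry (lookup B i) (a ℤ.+ + toℕ q) ≡ true → p ≡ q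
      case-total p q hp hq with ≤-total (toℕ p) (toℕ q)
      ... | inj₁ p≤q = ordered i a p q p≤q hp hq
      ... | inj₂ q≤p = sym (ordered i a q p q≤p hq hp)

-- Optimality of the dynamic program

slice-∷ʳ : ∀ {r n} (A : Array r n) j → slice A 1ℤ (suc j) ≡ zipWith _∷ʳ_ (slice A 1ℤ j) (columnAt A (+ suc j))
slice-∷ʳ []      j = refl
slice-∷ʳ (v ∷ A) j = cong₂ _∷_ (tabulate-∷ʳ j (λ t → entry v (+ suc t))) (slice-∷ʳ A j)

slice-all : ∀ {r n} (A : Array r n) → slice A 1ℤ n ≡ A
slice-all {n = n} A = array-ext λ i p → trans (lookup-slice A 1ℤ n i p) (trans (entry-at (lookup A i) (toℕ p)) (at-lookup (lookup A i) p))

slice-zero : ∀ {r n} (A : Array r n) a → aired (slice A a 0) ≡ 0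
slice-zero []      a = refl
slice-zero (v ∷ A) a = slice-zero A a

aired-empty : ∀ r → aired (replicate r []) ≡ 0
aired-empty zero    = refl
aired-empty (suc r) = aired-empty r

module _ {k n : ℕ} (G : Array k n) (l w : ℕ) (T : Tables G l w) where
  open Tables T renaming (MIS to mis)

  private
    ω : ℕ
    ω = suc w
    R : (j : ℕ) → Array k ω → Array k j
    R = retrieve G l w pred

  -- An inequality, since another schedule with the same last window may air more. The preceding
  -- window of `B` is among the candidates over which `pred` is maximal.
  mis-bound : ∀ {B} → Schedule G l ω B → ∀ j → j ≤ n → aired (slice B 1ℤ j) ≤ mis j (window B ω j)
  mis-bound {B} sch zero    _ = ≤-trans (≤-reflexive (slice-zero B 1ℤ)) z≤n
  mis-bound {B} sch (suc j) j<n = begin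
    aired (slice B 1ℤ (suc j))                              ≡⟨ cong aired (slice-∷ʳ B j) ⟩
    aired (zipWith _∷ʳ_ (slice B 1ℤ j) (columnAt B (+ suc j))) ≡⟨ aired-∷ʳ (slice B 1ℤ j) _ ⟩
    aired (slice B 1ℤ j) + ∣ columnAt B (+ suc j) ∣         ≤⟨ +-monoˡ-≤ _ (mis-bound sch j (<⇒≤ j<n)) ⟩
    mis j V + ∣ columnAt B (+ suc j) ∣                      ≡⟨ +-comm (mis j V) _ ⟩
    ∣ columnAt B (+ suc j) ∣ + mis j V                      ≡⟨ cong (λ u → ∣ u ∣ + mis j V) (last-window B w j) ⟨
    ∣ map last W ∣ + mis j V                                ≡⟨ cong (_+ mis j V) (⟨,⟩-≤ (map last W) (columnAt G (+ suc j)) (𝓕-last G l w j W W∈)) ⟨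
    ⟨ map last W , columnAt G (+ suc j) ⟩ + mis j V         ≤⟨ +-monoʳ-≤ ⟨ map last W , columnAt G (+ suc j) ⟩
                                                                 (proj₂ (choice j j<n W W∈) V (schedule⇒window∈𝓕 G l sch j , window-⊨ B w j)) ⟩
    ⟨ map last W , columnAt G (+ suc j) ⟩ + mis j (pred (suc j) W) ≡⟨ update j j<n W W∈ ⟨
    mis (suc j) W                                           ∎
    where
    open ≤-Reasoning
    V = window B ω j
    W = window B ω (suc j)
    W∈ = schedule⇒window∈𝓕 G l sch (suc j)

  aired-retrieve : ∀ j → j ≤ n → ∀ W → 𝓕 G l j W → aired (R j W) ≡ mis j W
  -- `base` fixes the table at `𝟎` only, which is the one window in `𝓕` at time 0.
  aired-retrieve zero    _   W W∈ = trans (aired-empty k) (sym (trans (cong (mis 0) (𝓕0⇒𝟎 G l w W W∈)) base))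
  aired-retrieve (suc j) j<n W W∈ = begin
    aired (R (suc j) W)                                            ≡⟨ aired-∷ʳ (R j V) (map last W) ⟩
    aired (R j V) + ∣ map last W ∣                                 ≡⟨ cong₂ _+_ (aired-retrieve j (<⇒≤ j<n) V V∈) (sym (⟨,⟩-≤ (map last W) (columnAt G (+ suc j)) (𝓕-last G l w j W W∈))) ⟩
    mis j V + ⟨ map last W , columnAt G (+ suc j) ⟩                ≡⟨ +-comm (mis j V) _ ⟩
    ⟨ map last W , columnAt G (+ suc j) ⟩ + mis j V                ≡⟨ update j j<n W W∈ ⟨
    mis (suc j) W                                                  ∎
    where
    open ≡-Reasoning
    V = pred (suc j) W
    V∈ = proj₁ (proj₁ (choice j j<n W W∈))

  lookup-retrieve : ∀ j W i → lookup (R (suc j) W) i ≡ lookup (R j (pred (suc j) W)) i ∷ʳ last (lookup W i)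
  lookup-retrieve j W i = trans (lookup-zipWith _∷ʳ_ i (R j (pred (suc j) W)) (map last W))
    (cong (lookup (R j (pred (suc j) W)) i ∷ʳ_) (lookup-map i last W))

  padded-retrieve : ∀ j W i {c} → c ≤ j + ω → padded ω (lookup (R (suc j) W) i) c ≡ padded ω (lookup (R j (pred (suc j) W)) i) c
  padded-retrieve j W i {c} c≤ with paddedIndex ω c
  ... | before-start c≤ω = trans (padded-≤ ω (lookup (R (suc j) W) i) c≤ω) (sym (padded-≤ ω (lookup (R j (pred (suc j) W)) i) c≤ω))
  ... | time t refl = begin
    padded ω (lookup (R (suc j) W) i) (ω + suc t)             ≡⟨ padded-at ω (lookup (R (suc j) W) i) t ⟩
    at (lookup (R (suc j) W) i) t                             ≡⟨ cong (λ v → at v t) (lookup-retrieve j W i) ⟩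
    at (lookup (R j (pred (suc j) W)) i ∷ʳ last (lookup W i)) t ≡⟨ at-∷ʳ-< (lookup (R j (pred (suc j) W)) i) _ t<j ⟩
    at (lookup (R j (pred (suc j) W)) i) t                    ≡⟨ padded-at ω (lookup (R j (pred (suc j) W)) i) t ⟨
    padded ω (lookup (R j (pred (suc j) W)) i) (ω + suc t)    ∎
    where
    open ≡-Reasoning
    t<j : t < j
    t<j = +-cancelˡ-≤ ω _ _ (≤-trans c≤ (≤-reflexive (+-comm j ω)))

  -- `retrieve` takes only the last column of each window. The other columns of `W` reappear because
  -- they are shared with `pred`, whose whole window is recovered by induction.
  window-retrieve : ∀ j → j ≤ n → ∀ W → 𝓕 G l j W → window (R j W) ω j ≡ W
  window-retrieve zero _ W W∈ = trans
    (array-ext λ i p → trans (lookup-window (R 0 W) ω 0 i p) (trans (padded-≤ ω (lookup (R 0 W) i) (toℕ<n p)) (sym (𝟎-false i p))))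
    (sym (𝓕0⇒𝟎 G l w W W∈))
  window-retrieve (suc j) j<n W W∈ = array-ext λ i p → helper i p (snoc p)
    where
    open ≡-Reasoning
    V = pred (suc j) W
    V∈ = proj₁ (proj₁ (choice j j<n W W∈))
    V⊨W = proj₂ (proj₁ (choice j j<n W W∈))
    helper : ∀ i p → Snoc p → window (R (suc j) W) ω (suc j) [ i , p ] ≡ W [ i , p ]
    helper i _ end = begin
      window (R (suc j) W) ω (suc j) [ i , fromℕ w ]       ≡⟨ lookup-window-last (R (suc j) W) w j i ⟩
      at (lookup (R (suc j) W) i) j                        ≡⟨ cong (λ v → at v j) (lookup-retrieve j W i) ⟩
      at (lookup (R j V) i ∷ʳ last (lookup W i)) j         ≡⟨ at-∷ʳ-≡ (lookup (R j V) i) _ ⟩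
      last (lookup W i)                                    ≡⟨ last-lookup (lookup W i) ⟩
      W [ i , fromℕ w ]                                    ∎
    helper i _ (body p) = begin
      window (R (suc j) W) ω (suc j) [ i , inject₁ p ]             ≡⟨ ⊨⇒shift {A = window (R (suc j) W) ω j} {B = window (R (suc j) W) ω (suc j)} (window-⊨ (R (suc j) W) w j) i p ⟨
      window (R (suc j) W) ω j [ i , suc p ]                       ≡⟨ lookup-window (R (suc j) W) ω j i (suc p) ⟩
      padded ω (lookup (R (suc j) W) i) (j + suc (toℕ (suc p)))    ≡⟨ padded-retrieve j W i (+-monoʳ-≤ j (s≤s (toℕ<n p))) ⟩
      padded ω (lookup (R j V) i) (j + suc (toℕ (suc p)))          ≡⟨ lookup-window (R j V) ω j i (suc p) ⟨
      window (R j V) ω j [ i , suc p ]                             ≡⟨ cong (_[ i , suc p ]) (window-retrieve j (<⇒≤ j<n) V V∈) ⟩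
      V [ i , suc p ]                                              ≡⟨ ⊨⇒shift {A = V} {B = W} V⊨W i p ⟩
      W [ i , inject₁ p ]                                          ∎

  -- A window that ends before `j` does not see the last column appended, so it is already a window
  -- of the retrieval from `pred`.
  windows-retrieve∈𝓕 : ∀ j → j ≤ n → ∀ W → 𝓕 G l j W → ∀ t → t ≤ j → 𝓕 G l t (window (R j W) ω t)
  windows-retrieve∈𝓕 j j≤n W W∈ t t≤j with m≤n⇒m<n∨m≡n t≤j
  ... | inj₂ refl = subst (𝓕 G l j) (sym (window-retrieve j j≤n W W∈)) W∈
  windows-retrieve∈𝓕 (suc j) j<n W W∈ t _ | inj₁ (s≤s t≤j) =
    subst (𝓕 G l t) (array-ext {A = window (R j V) ω t} {B = window (R (suc j) W) ω t} same) (windows-retrieve∈𝓕 j (<⇒≤ j<n) V (proj₁ (proj₁ (choice j j<n W W∈))) t t≤j)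
    where
    V = pred (suc j) W
    same : ∀ i p → window (R j V) ω t [ i , p ] ≡ window (R (suc j) W) ω t [ i , p ]
    same i p = trans (lookup-window (R j V) ω t i p) (trans (sym (padded-retrieve j W i (+-mono-≤ t≤j (toℕ<n p))))
      (sym (lookup-window (R (suc j) W) ω t i p)))

returns⇒optimal : ∀ {k n} (G : Array k n) l w I → Returns G l w I → Optimal G l (suc w) I
returns⇒optimal {n = n} G l w _ (T , W , (W∈ , W-max) , refl) =
  windows∈𝓕⇒schedule G l (windows-retrieve∈𝓕 G l w T n ≤-refl W W∈) , λ B sch → begin
    aired B                          ≡⟨ cong aired (slice-all B) ⟨
    aired (slice B 1ℤ n)             ≤⟨ mis-bound G l w T sch n ≤-refl ⟩
    mis n (window B (suc w) n)       ≤⟨ W-max _ (schedule⇒window∈𝓕 G l sch n) ⟩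
    mis n W                          ≡⟨ aired-retrieve G l w T n ≤-refl W W∈ ⟨
    aired (retrieve G l w pred n W)  ∎
  where
  open Tables T renaming (MIS to mis)
  open ≤-Reasoning

open Outcome

-- Reasoning about programs

≡ᵇ-true : ∀ {x y} → (x ≡ᵇ y) ≡ true → x ≡ y
≡ᵇ-true {x} {y} h = ≡ᵇ⇒≡ x y (subst T (sym h) tt)

≡ᵇ-false : ∀ {x y} → (x ≡ᵇ y) ≡ false → x ≢ y
≡ᵇ-false {x} {y} h x≡y = subst T h (≡⇒≡ᵇ x y x≡y)

≡ᵇ-refl : ∀ x → (x ≡ᵇ x) ≡ true
≡ᵇ-refl zero    = refl
≡ᵇ-refl (suc x) = ≡ᵇ-refl x

≢⇒≡ᵇ-false : ∀ {x y} → x ≢ y → (x ≡ᵇ y) ≡ false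
≢⇒≡ᵇ-false {x} {y} x≢y with x ≡ᵇ y in eq
... | true  = contradiction (≡ᵇ-true eq) x≢y
... | false = refl

Post : ℕ → ℕ → Set₁
Post k r = Vec ℕ r → Store k → Set

-- A Hoare triple with a fixed initial store. As a record type it keeps program, store and
-- postcondition visible to unification, where `run` would compute.
record Ends {k r} (p : Prog ℕ k r) (s : Store k) (Q : Post k r) : Set where
  constructor ends
  field holds : Q (words (run p s)) (store (run p s))

open Ends

private
  variable
    k q r : ℕ
    s : Store k

ends-mono : {p : Prog ℕ k r} {Q Q′ : Post k r} → (∀ xs s′ → Q xs s′ → Q′ xs s′) → Ends p s Q → Ends p s Q′
ends-mono f (ends h) = ends (f _ _ h)

ret-ends : ∀ {xs : Vec ℕ r} {Q : Post k r} → Q xs s → Ends (ret xs) s Q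
ret-ends h = ends h

bind-ends : {p : Prog ℕ k q} {c : Vec ℕ q → Prog ℕ k r} {Q : Post k r} →
  Ends p s (λ xs s′ → Ends (c xs) s′ Q) → Ends (bind p c) s Q
bind-ends h = ends (holds (holds h))

add-ends : ∀ {x y} {c : ℕ → Prog ℕ k r} {Q : Post k r} → Ends (c (x + y)) s Q → Ends (add x y c) s Q
add-ends h = ends (holds h)

lit-ends : ∀ {m} {c : ℕ → Prog ℕ k r} {Q : Post k r} → Ends (c m) s Q → Ends (lit m c) s Q
lit-ends h = ends (holds h)

-- `x + 1` does not compute to `suc x`, the form in which times and loop bounds are used in the
-- invariants.
add-1-ends : ∀ {x} {c : ℕ → Prog ℕ k r} {Q : Post k r} → Ends (c (suc x)) s Q → Ends (add x 1 c) s Q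
add-1-ends {s = s} {x} {c} {Q} h = add-ends (subst (λ y → Ends (c y) s Q) (+-comm 1 x) h)

sub-ends : ∀ {x y} {c : ℕ → Prog ℕ k r} {Q : Post k r} → Ends (c (x ∸ y)) s Q → Ends (sub x y c) s Q
sub-ends h = ends (holds h)

read-ends : ∀ {x is} {c : ℕ → Prog ℕ k r} {Q : Post k r} → Ends (c (s x is)) s Q → Ends (read x is c) s Q
read-ends h = ends (holds h)

write-ends : ∀ {x is v} {p : Prog ℕ k r} {Q : Post k r} → Ends p (s [ x , is ]≔ v) Q → Ends (write x is v p) s Q
write-ends h = ends (holds h)

private
  branch : {Q : Post k r} (b : Bool) (o o′ : Outcome k r) →
    (b ≡ true → Q (words o) (store o)) → (b ≡ false → Q (words o′) (store o′)) →
    Q (words (if b then o else o′)) (store (if b then o else o′))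
  branch true  _ _ f _ = f refl
  branch false _ _ _ g = g refl

if≡-ends : ∀ {x y} {p p′ : Prog ℕ k r} {Q : Post k r} →
  (x ≡ y → Ends p s Q) → (x ≢ y → Ends p′ s Q) → Ends (if≡ x y p p′) s Q
if≡-ends {Q = Q} f g = ends (branch {Q = Q} _ _ _ (λ h → holds (f (≡ᵇ-true h))) (λ h → holds (g (≡ᵇ-false h))))

if≤-ends : ∀ {x y} {p p′ : Prog ℕ k r} {Q : Post k r} →
  (x ≤ y → Ends p s Q) → (¬ x ≤ y → Ends p′ s Q) → Ends (if≤ x y p p′) s Q
if≤-ends {x = x} {y} {Q = Q} f g = ends (branch {Q = Q} _ _ _
  (λ h → holds (f (≤ᵇ⇒≤ x y (subst T (sym h) tt)))) (λ h → holds (g (λ x≤y → subst T h (≤⇒≤ᵇ x≤y)))))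

iterate-invariant : {X : Set} {f : ℕ → X → X} (P : ℕ → X → Set) {x : X} (b : ℕ) →
  (∀ i → i < b → ∀ y → P i y → P (suc i) (f i y)) → P 0 x → P b (iterate b f x)
iterate-invariant P zero    step h = h
iterate-invariant P (suc b) step h =
  step b ≤-refl _ (iterate-invariant P b (λ i i<b → step i (m<n⇒m<1+n i<b)) h)

for-ends : ∀ {b} {xs : Vec ℕ q} {body} (Inv : ℕ → Post k q) → Inv 0 xs s →
  (∀ i → i < b → ∀ ys s′ → Inv i ys s′ → Ends (body i ys) s′ (Inv (suc i))) →
  Ends (for b xs body) s (Inv b)
for-ends {b = b} Inv h step = ends (iterate-invariant (λ i o → Inv i (words o) (store o)) b
  (λ i i<b o inv → holds (step i i<b (words o) (store o) inv)) h)

Yields : Prog ℕ k r → Store k → Vec ℕ r → Set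
Yields p s xs = Ends p s (λ ys s′ → ys ≡ xs × s′ ≡ s)

bind-yields : {p : Prog ℕ k q} {c : Vec ℕ q → Prog ℕ k r} {Q : Post k r} {xs : Vec ℕ q} →
  Yields p s xs → Ends (c xs) s Q → Ends (bind p c) s Q
bind-yields {s = s} {c = c} {Q} y h = bind-ends (ends-mono (λ _ _ (ys≡ , s≡) → subst₂ (λ ys s′ → Ends (c ys) s′ Q) (sym ys≡) (sym s≡) h) y)

ret-yields : ∀ {xs : Vec ℕ r} → Yields {k} (ret xs) s xs
ret-yields = ends (refl , refl)

sumOver : ∀ {A : Set} → (A → ℕ) → List A → ℕ
sumOver g = foldr (λ i a → a + g i) 0

foldr-yields : ∀ {A : Set} {F : A → Prog ℕ k 1 → Prog ℕ k 1} {p} (g : A → ℕ) →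
  (∀ i rest v → Yields rest s (v ∷ []) → Yields (F i rest) s (v + g i ∷ [])) →
  Yields p s (0 ∷ []) → ∀ xs → Yields (foldr F p xs) s (sumOver g xs ∷ [])
foldr-yields g step h []       = h
foldr-yields g step h (i ∷ xs) = step i _ _ (foldr-yields g step h xs)

-- The tests are chained in continuation-passing style: each goes on to the next one or jumps to
-- `reject`. Thus `accept` may assume all the conditions, and `reject` the failure of one.
foldr-guard : ∀ {A : Set} {F : A → Prog ℕ k r → Prog ℕ k r} {accept reject} {Q : Post k r} (P : A → Set) →
  (∀ i next → (P i → Ends next s Q) → (¬ P i → Ends reject s Q) → Ends (F i next) s Q) →
  ∀ xs → ((∀ i → i ∈ xs → P i) → Ends accept s Q) → (∀ i → ¬ P i → Ends reject s Q) → Ends (foldr F accept xs) s Q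
foldr-guard P step []       acc rej = acc (λ _ ())
foldr-guard P step (i ∷ xs) acc rej = step i _
  (λ Pi → foldr-guard P step xs (λ all → acc λ { _ (here refl) → Pi ; j (there j∈) → all j j∈ }) rej)
  (rej i)

write-same : ∀ (s : Store k) x is v → (s [ x , is ]≔ v) x is ≡ v
write-same s x is v rewrite dec-true ((x ≟ₙ x) ×-dec List.≡-dec ℕ._≟_ is is) (refl , refl) = refl

write-other : ∀ (s : Store k) x is v {y js} → ¬ (x ≡ y × is ≡ js) → (s [ x , is ]≔ v) y js ≡ s y js
write-other s x is v {y} {js} ne rewrite dec-false ((x ≟ₙ y) ×-dec List.≡-dec ℕ._≟_ is js) ne = refl

-- If the cells coincide, the write puts back the same value; so callers need not tell them apart.
write-keeps : ∀ (s : Store k) x is {v y js} u → ((x ≡ y × is ≡ js) → v ≡ u) → s y js ≡ u → (s [ x , is ]≔ v) y js ≡ u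
write-keeps s x is {v} {y} {js} u same h with (x ≟ₙ y) ×-dec List.≡-dec ℕ._≟_ is js
... | yes (refl , refl) = trans (write-same s x is v) (same (refl , refl))
... | no  ne = trans (write-other s x is v ne) h

-- The list may repeat an element. The second clause lets the cell written for the head keep its
-- value while the tail is processed.
foldr-write : ∀ {F : Fin k → Prog ℕ k 0 → Prog ℕ k 0} (cell : Fin k → Name k) (is : List ℕ) (val : Fin k → ℕ) →
  (∀ {a b} → cell a ≡ cell b → a ≡ b) →
  (∀ a next s Q → Ends next (s [ cell a , is ]≔ val a) Q → Ends (F a next) s Q) →
  ∀ xs (s : Store k) → Ends (foldr F (ret []) xs) s (λ _ s′ →
    (∀ a → a ∈ xs → s′ (cell a) is ≡ val a) ×
    (∀ a → s (cell a) is ≡ val a → s′ (cell a) is ≡ val a) ×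
    (∀ y js → (∀ a → ¬ (cell a ≡ y × is ≡ js)) → s′ y js ≡ s y js))
foldr-write cell is val inj step []       s = ret-ends ((λ _ ()) , (λ _ h → h) , λ _ _ _ → refl)
foldr-write cell is val inj step (i ∷ xs) s = step i _ s _ (ends-mono
  (λ _ s′ (written , kept , other) →
    (λ { a (here refl) → kept a (write-same s (cell a) is (val a)) ; a (there a∈) → written a a∈ }) ,
    (λ a h → kept a (write-keeps s (cell i) is (val a) (λ (eq , _) → cong val (inj eq)) h)) ,
    (λ y js ne → trans (other y js ne) (write-other s (cell i) is (val i) (ne i))))
  (foldr-write cell is val inj step xs (s [ cell i , is ]≔ val i)))

-- Nested loops over vectors of words

module _ {k : ℕ} (n l ω z o : ℕ) where
  open Program {ℕ} {k} n l ω z o using (forVec)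

  -- Goals are indexed by X through f, not by the vectors themselves, so that
  -- an inner loop also keeps the goals of the other outer iterations.
  forVec-ends : ∀ {X : Set} m b (f : Vec ℕ m → X) {xs : Vec ℕ q} {body} {s : Store k} (Frame : Post k q) (Goal : X → Post k q) →
    (∀ ps → (∀ i → lookup ps i < b) → ∀ ys s′ → Frame ys s′ →
      Ends (body ps ys) s′ (λ ys′ s″ → Frame ys′ s″ × Goal (f ps) ys′ s″ × (∀ x → Goal x ys s′ → Goal x ys′ s″))) →
    Frame xs s →
    Ends (forVec m b xs body) s (λ ys′ s″ →
      Frame ys′ s″ × (∀ ps → (∀ i → lookup ps i < b) → Goal (f ps) ys′ s″) × (∀ x → Goal x xs s → Goal x ys′ s″))
  forVec-ends zero b f {xs} {s = s} Frame Goal step frame = ends-mono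
    (λ _ _ (fr , goal , keep) → fr , (λ { [] _ → goal }) , keep)
    (step [] (λ ()) xs s frame)
  forVec-ends (suc m) b f {xs} {s = s} Frame Goal step frame = ends-mono
    (λ _ _ (fr , goal , keep) → fr , (λ { (p ∷ ps) lt → goal p (lt zero) ps (λ i → lt (suc i)) }) , keep)
    (for-ends Inv (frame , (λ _ ()) , λ _ h → h) outer)
    where
    Inv : ℕ → Post _ _
    Inv i ys s′ = Frame ys s′ × (∀ p → p < i → ∀ ps → (∀ a → lookup ps a < b) → Goal (f (p ∷ ps)) ys s′) ×
      (∀ x → Goal x xs s → Goal x ys s′)
    outer : ∀ i → i < b → ∀ ys s′ → Inv i ys s′ → Ends _ s′ (Inv (suc i))
    outer i i<b ys s′ (fr , goal , keep) = ends-mono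
      (λ ys′ s″ (fr′ , goal′ , keep′) → fr′ ,
        (λ p p<1+i ps lt → case-last p p<1+i ps lt goal′ keep′) ,
        (λ x h → keep′ x (keep x h)))
      (forVec-ends m b (λ ps → f (i ∷ ps)) Frame Goal
        (λ ps lt → step (i ∷ ps) (λ { zero → i<b ; (suc a) → lt a })) fr)
      where
      case-last : ∀ {ys′ s″} p → p < suc i → ∀ ps → (∀ a → lookup ps a < b) →
        (∀ ps → (∀ a → lookup ps a < b) → Goal (f (i ∷ ps)) ys′ s″) →
        (∀ x → Goal x ys s′ → Goal x ys′ s″) → Goal (f (p ∷ ps)) ys′ s″
      case-last p p<1+i ps lt goal′ keep′ with p ℕ.≟ i
      ... | yes refl = goal′ ps lt
      ... | no  p≢i  = keep′ _ (goal p (≤∧≢⇒< (≤-pred p<1+i) p≢i) ps lt)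

-- Arrays held in words

decodeRow : ∀ {m} → ℕ → Vec Bool m
decodeRow p = tabulate λ q → suc (toℕ q) ≡ᵇ p

decode : ∀ {r m} → Vec ℕ r → Array r m
decode = map decodeRow

-- A zero entry put in front moves a position one to the right, but the word 0 means that there is
-- no position and stays 0.
bump : ℕ → ℕ
bump zero    = 0
bump (suc p) = suc (suc p)

encodeRow : ∀ {m} → Vec Bool m → ℕ
encodeRow []          = 0
encodeRow (true ∷ v)  = 1
encodeRow (false ∷ v) = bump (encodeRow v)

encode : ∀ {r m} → Array r m → Vec ℕ r
encode = map encodeRow

decodeRow-bump : ∀ {m} e → decodeRow {suc m} (bump e) ≡ false ∷ decodeRow e
decodeRow-bump zero    = refl
decodeRow-bump (suc e) = refl

decode-encodeRow : ∀ {m} (v : Vec Bool m) → ∣ v ∣ ≤ 1 → decodeRow (encodeRow v) ≡ v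
decode-encodeRow []          _       = refl
decode-encodeRow (true ∷ v)  (s≤s h) = cong (true ∷_) (lookup-ext λ p → trans (lookup∘tabulate _ p) (sym (∣∣≡0⇒none v h p)))
decode-encodeRow (false ∷ v) h       = trans (decodeRow-bump (encodeRow v)) (cong (false ∷_) (decode-encodeRow v h))

encode-decodeRow : ∀ m {p} → p ≤ m → encodeRow (decodeRow {m} p) ≡ p
encode-decodeRow zero    {zero}        _       = refl
encode-decodeRow (suc m) {zero}        _       = cong bump (encode-decodeRow m z≤n)
encode-decodeRow (suc m) {suc zero}    _       = refl
encode-decodeRow (suc m) {suc (suc p)} (s≤s h) = cong bump (encode-decodeRow m h)

encodeRow-≤ : ∀ {m} (v : Vec Bool m) → encodeRow v ≤ m
encodeRow-≤ []          = z≤n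
encodeRow-≤ (true ∷ v)  = s≤s z≤n
encodeRow-≤ (false ∷ v) with encodeRow v | encodeRow-≤ v
... | zero  | _ = z≤n
... | suc _ | h = s≤s h

lookup-decode : ∀ {r m} (W : Vec ℕ r) i p → decode {m = m} W [ i , p ] ≡ (suc (toℕ p) ≡ᵇ lookup W i)
lookup-decode {m = m} W i p rewrite lookup-map i (decodeRow {m}) W = lookup∘tabulate _ p

last-decode : ∀ {r m} (W : Vec ℕ r) i → lookup (map last (decode {m = suc m} W)) i ≡ (suc m ≡ᵇ lookup W i)
last-decode {m = m} W i = begin
  lookup (map last (decode W)) i              ≡⟨ lookup-map i last (decode {m = suc m} W) ⟩
  last (lookup (decode {m = suc m} W) i)      ≡⟨ last-lookup (lookup (decode {m = suc m} W) i) ⟩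
  decode W [ i , fromℕ m ]                    ≡⟨ lookup-decode W i (fromℕ m) ⟩
  (suc (toℕ (fromℕ m)) ≡ᵇ lookup W i)         ≡⟨ cong (λ x → suc x ≡ᵇ lookup W i) (toℕ-fromℕ m) ⟩
  (suc m ≡ᵇ lookup W i)                       ∎
  where open ≡-Reasoning

InBox : ∀ {r} → ℕ → Vec ℕ r → Set
InBox ω W = ∀ i → lookup W i ≤ ω

decode-encode : ∀ {r m} (W : Array r m) → (∀ i → ∣ lookup W i ∣ ≤ 1) → decode (encode W) ≡ W
decode-encode W h = lookup-ext λ i → trans (lookup-map i decodeRow (encode W))
  (trans (cong decodeRow (lookup-map i encodeRow W)) (decode-encodeRow (lookup W i) (h i)))

encode-decode : ∀ {r m} {W : Vec ℕ r} → InBox m W → encode (decode {m = m} W) ≡ W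
encode-decode {m = m} {W} h = lookup-ext λ i → trans (lookup-map i encodeRow (decode {m = m} W))
  (trans (cong encodeRow (lookup-map i (decodeRow {m}) W)) (encode-decodeRow m (h i)))

encode-InBox : ∀ {r m} (W : Array r m) → InBox m (encode W)
encode-InBox {m = m} W i = subst (_≤ m) (sym (lookup-map i encodeRow W)) (encodeRow-≤ (lookup W i))

decode-unique : ∀ {r m} (W : Vec ℕ r) i → ∣ lookup (decode {m = m} W) i ∣ ≤ 1
decode-unique {m = m} W i = unique⇒∣∣≤1 (lookup (decode W) i) λ p q hp hq →
  toℕ-injective (suc-injective (trans (position p hp) (sym (position q hq))))
  where
  position : ∀ p → decode {m = m} W [ i , p ] ≡ true → suc (toℕ p) ≡ lookup W i
  position p hp = ≡ᵇ-true (trans (sym (lookup-decode W i p)) hp)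

decode-zeros : ∀ {r m} → decode {r} {m} (replicate r 0) ≡ 𝟎
decode-zeros {r} {m} = array-ext λ i p →
  trans (lookup-decode (replicate r 0) i p) (trans (cong (suc (toℕ p) ≡ᵇ_) (lookup-replicate i 0)) (sym (𝟎-false i p)))

zeros-InBox : ∀ {r} m → InBox m (replicate r 0)
zeros-InBox m i = subst (_≤ m) (sym (lookup-replicate i 0)) z≤n

encode-𝟎 : ∀ {r m} → encode {r} {m} 𝟎 ≡ replicate r 0
encode-𝟎 {r} {m} = trans (cong encode (sym decode-zeros)) (encode-decode (zeros-InBox m))

sumOver-tabulate : ∀ {A : Set} {m} (f : Fin m → A) (g : A → ℕ) (xs : Vec ℕ m) →
  (∀ i → g (f i) ≡ lookup xs i) → sumOver g (List.tabulate f) ≡ sum xs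
sumOver-tabulate f g []       h = refl
sumOver-tabulate f g (x ∷ xs) h = trans (cong₂ _+_ (sumOver-tabulate (λ i → f (suc i)) g xs (λ i → h (suc i))) (h zero)) (+-comm (sum xs) x)

∣∣-sum : ∀ {m} (v : Vec Bool m) → ∣ v ∣ ≡ sum (map bit v)
∣∣-sum []      = refl
∣∣-sum (b ∷ v) = trans (∣∷∣ b v) (cong (λ x → bit b + x) (∣∣-sum v))

∣∣-positive : ∀ {m} (v : Vec Bool m) → ∣ v ∣ ≡ 0 ⊎ Σ[ p ∈ Fin m ] lookup v p ≡ true
∣∣-positive []          = inj₁ refl
∣∣-positive (true ∷ v)  = inj₂ (zero , refl)
∣∣-positive (false ∷ v) with ∣∣-positive v
... | inj₁ h       = inj₁ h
... | inj₂ (p , h) = inj₂ (suc p , h)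

occurrences : ∀ {r} → Vec ℕ r → ℕ → ℕ
occurrences {r} W c = sumOver (λ i → bit (lookup W i ≡ᵇ c)) (allFin r)

≡ᵇ-sym : ∀ x y → (x ≡ᵇ y) ≡ (y ≡ᵇ x)
≡ᵇ-sym zero    zero    = refl
≡ᵇ-sym zero    (suc y) = refl
≡ᵇ-sym (suc x) zero    = refl
≡ᵇ-sym (suc x) (suc y) = ≡ᵇ-sym x y

occurrences-column : ∀ {r m} (W : Vec ℕ r) (p : Fin m) → occurrences W (suc (toℕ p)) ≡ ∣ column (decode {m = m} W) p ∣
occurrences-column {r} {m} W p = trans
  (sumOver-tabulate (λ i → i) _ (map bit (column (decode {m = m} W) p)) (λ i → sym (begin
    lookup (map bit (column (decode {m = m} W) p)) i   ≡⟨ lookup-map i bit (column (decode {m = m} W) p) ⟩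
    bit (lookup (column (decode {m = m} W) p) i)       ≡⟨ cong bit (lookup-column (decode {m = m} W) p i) ⟩
    bit (decode {m = m} W [ i , p ])                   ≡⟨ cong bit (lookup-decode {m = m} W i p) ⟩
    bit (suc (toℕ p) ≡ᵇ lookup W i)            ≡⟨ cong bit (≡ᵇ-sym (suc (toℕ p)) (lookup W i)) ⟩
    bit (lookup W i ≡ᵇ suc (toℕ p))            ∎)))
  (sym (∣∣-sum (column (decode {m = m} W) p)))
  where open ≡-Reasoning

-- One row of a predecessor. An entry of `W` before the last column sits one position later in the
-- preceding window. If the row of `W` is zero outside its last column, only the first column of the
-- predecessor is free, so its word is the bit itself: 0 for no entry, 1 for position 1.
shift : ℕ → ℕ → ℕ → ℕ
shift ω b p = if p ≡ᵇ 0 then b else (if p ≡ᵇ ω then b else p + 1)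

shift-keep : ∀ {ω} b {p} → p ≡ 0 ⊎ p ≡ ω → shift ω b p ≡ b
shift-keep b (inj₁ refl) = refl
shift-keep {ω} b {p} (inj₂ refl) with ω ≡ᵇ 0
... | true = refl
... | false rewrite ≡ᵇ-refl ω = refl

shift-move : ∀ {ω} b {p} → p ≢ 0 → p ≢ ω → shift ω b p ≡ suc p
shift-move b {p} p≢0 p≢ω rewrite ≢⇒≡ᵇ-false p≢0 | ≢⇒≡ᵇ-false p≢ω = +-comm p 1

ends-or-middle : ∀ ω p → (p ≡ 0 ⊎ p ≡ ω) ⊎ (p ≢ 0 × p ≢ ω)
ends-or-middle ω p with p ℕ.≟ 0 | p ℕ.≟ ω
... | yes eq | _      = inj₁ (inj₁ eq)
... | no  _  | yes eq = inj₁ (inj₂ eq)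
... | no  a  | no  b  = inj₂ (a , b)

shift-≤ : ∀ {w b p} → b < 2 → p ≤ suc w → shift (suc w) b p ≤ suc w
shift-≤ {w} {b} {p} (s≤s b≤1) p≤ with ends-or-middle (suc w) p
... | inj₁ e rewrite shift-keep b e = ≤-trans b≤1 (s≤s z≤n)
... | inj₂ (p≢0 , p≢ω) rewrite shift-move b p≢0 p≢ω = ≤∧≢⇒< p≤ p≢ω

-- If the bit is used, both sides are false: a word below 2 names no position from 2 on, and neither
-- 0 nor ω is among the positions 1 ... w.
shift-sound : ∀ {w b p} x → b < 2 → x < w → (suc (suc x) ≡ᵇ shift (suc w) b p) ≡ (suc x ≡ᵇ p)
shift-sound {w} {b} {p} x (s≤s b≤1) x<w with ends-or-middle (suc w) p
... | inj₂ (p≢0 , p≢ω) rewrite shift-move b p≢0 p≢ω = refl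
... | inj₁ e rewrite shift-keep b e = trans (≢⇒≡ᵇ-false λ eq → <⇒≱ (s≤s (s≤s z≤n)) (≤-trans (≤-reflexive eq) b≤1)) (sym (≢⇒≡ᵇ-false (ne e)))
  where
  ne : p ≡ 0 ⊎ p ≡ suc w → suc x ≢ p
  ne (inj₁ refl) ()
  ne (inj₂ refl) refl = <-irrefl refl x<w

shift-complete : ∀ {w p v} → p ≤ suc w → v ≤ suc w → (∀ x → x < w → (suc (suc x) ≡ᵇ v) ≡ (suc x ≡ᵇ p)) →
  Σ[ b ∈ ℕ ] (b < 2 × shift (suc w) b p ≡ v)
shift-complete {w} {p} {v} p≤ v≤ h with ends-or-middle (suc w) p | v <? 2
... | inj₁ e | yes v<2 = v , v<2 , shift-keep v e
-- The bit is ignored in this case, so 0 serves as well as 1.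
... | inj₂ (p≢0 , p≢ω) | _ = 0 , s≤s z≤n , trans (shift-move 0 p≢0 p≢ω) (move p p≢0 p≢ω p≤ h)
  where
  move : ∀ p → p ≢ 0 → p ≢ suc w → p ≤ suc w → (∀ x → x < w → (suc (suc x) ≡ᵇ v) ≡ (suc x ≡ᵇ p)) → suc p ≡ v
  move zero    p≢0 _   _  _ = contradiction refl p≢0
  move (suc x) _   p≢ω p≤ h = ≡ᵇ-true (trans (h x (≤-pred (≤∧≢⇒< p≤ p≢ω))) (≡ᵇ-refl x))
-- A word `v ≥ 2` forces `p = v - 1`, which lies strictly between 0 and ω.
... | inj₁ e | no v≮2 = contradiction e (middle v v≤ (≮⇒≥ v≮2) h)
  where
  middle : ∀ v → v ≤ suc w → 2 ≤ v → (∀ x → x < w → (suc (suc x) ≡ᵇ v) ≡ (suc x ≡ᵇ p)) → ¬ (p ≡ 0 ⊎ p ≡ suc w)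
  middle (suc zero)    _         (s≤s ())
  middle (suc (suc x)) (s≤s x<w) _ h e with ≡ᵇ-true {suc x} {p} (trans (sym (h x x<w)) (≡ᵇ-refl x)) | e
  ... | refl | inj₂ refl = <-irrefl refl x<w

predecessor : ∀ {r} → ℕ → Vec ℕ r → Vec ℕ r → Vec ℕ r
predecessor ω = zipWith (shift ω)

module _ {r w : ℕ} (W : Vec ℕ r) (W≤ : InBox (suc w) W) where

  predecessor-InBox : ∀ bs → (∀ i → lookup bs i < 2) → InBox (suc w) (predecessor (suc w) bs W)
  predecessor-InBox bs b<2 i rewrite lookup-zipWith (shift (suc w)) i bs W = shift-≤ {w} {lookup bs i} {lookup W i} (b<2 i) (W≤ i)

  predecessor-⊨ : ∀ bs → (∀ i → lookup bs i < 2) → decode {m = suc w} (predecessor (suc w) bs W) ⊨ decode W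
  predecessor-⊨ bs b<2 = shift⇒⊨ {A = decode (predecessor (suc w) bs W)} {B = decode W} λ i p → begin
    decode (predecessor (suc w) bs W) [ i , suc p ]                        ≡⟨ lookup-decode (predecessor (suc w) bs W) i (suc p) ⟩
    (suc (suc (toℕ p)) ≡ᵇ lookup (predecessor (suc w) bs W) i)             ≡⟨ cong (suc (suc (toℕ p)) ≡ᵇ_) (lookup-zipWith (shift (suc w)) i bs W) ⟩
    (suc (suc (toℕ p)) ≡ᵇ shift (suc w) (lookup bs i) (lookup W i))        ≡⟨ shift-sound {p = lookup W i} (toℕ p) (b<2 i) (toℕ<n p) ⟩
    (suc (toℕ p) ≡ᵇ lookup W i)                                            ≡⟨ cong (λ x → suc x ≡ᵇ lookup W i) (toℕ-inject₁ p) ⟨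
    (suc (toℕ (inject₁ p)) ≡ᵇ lookup W i)                                  ≡⟨ lookup-decode W i (inject₁ p) ⟨
    decode W [ i , inject₁ p ]                                             ∎
    where open ≡-Reasoning

  -- Completeness of the search over bits: the `2 ^ k` bit vectors reach all predecessors, some of
  -- them possibly more than once.
  ⊨-predecessor : ∀ V → InBox (suc w) V → decode {m = suc w} V ⊨ decode W →
    Σ[ bs ∈ Vec ℕ r ] ((∀ i → lookup bs i < 2) × predecessor (suc w) bs W ≡ V)
  ⊨-predecessor V V≤ V⊨W = tabulate (λ i → proj₁ (bits i)) ,
    (λ i → subst (_< 2) (sym (lookup∘tabulate _ i)) (proj₁ (proj₂ (bits i)))) ,
    lookup-ext λ i → trans (lookup-zipWith (shift (suc w)) i (tabulate λ i → proj₁ (bits i)) W)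
      (trans (cong (λ b → shift (suc w) b (lookup W i)) (lookup∘tabulate _ i)) (proj₂ (proj₂ (bits i))))
    where
    open ≡-Reasoning
    bits : ∀ i → Σ[ b ∈ ℕ ] (b < 2 × shift (suc w) b (lookup W i) ≡ lookup V i)
    bits i = shift-complete (W≤ i) (V≤ i) λ x x<w → begin
      (suc (suc x) ≡ᵇ lookup V i)                             ≡⟨ cong (λ y → suc (suc y) ≡ᵇ lookup V i) (toℕ-fromℕ< x<w) ⟨
      (suc (suc (toℕ (fromℕ< x<w))) ≡ᵇ lookup V i)            ≡⟨ lookup-decode V i (suc (fromℕ< x<w)) ⟨
      decode V [ i , suc (fromℕ< x<w) ]                       ≡⟨ ⊨⇒shift {A = decode V} {B = decode W} V⊨W i (fromℕ< x<w) ⟩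
      decode W [ i , inject₁ (fromℕ< x<w) ]                   ≡⟨ lookup-decode W i (inject₁ (fromℕ< x<w)) ⟩
      (suc (toℕ (inject₁ (fromℕ< x<w))) ≡ᵇ lookup W i)        ≡⟨ cong (λ y → suc y ≡ᵇ lookup W i) (trans (toℕ-inject₁ (fromℕ< x<w)) (toℕ-fromℕ< x<w)) ⟩
      (suc x ≡ᵇ lookup W i)                                   ∎

-- Dropping the last column and putting a zero column in front respects all conditions of `𝓕`. Hence
-- the maximum over predecessors is taken over a nonempty set.
𝓕-predecessor : ∀ {k n} (G : Array k n) l w j (W : Array k (suc w)) → 𝓕 G l (suc j) W →
  Σ[ V ∈ Array k (suc w) ] (𝓕 G l j V × V ⊨ W)
𝓕-predecessor {k} G l w j W (W≤ , rows≤ , cols≤) = V , (V≤ , rows′ , cols′) , V⊨W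
  where
  open ≡-Reasoning
  V : Array k (suc w)
  V = map (λ row → false ∷ init row) W
  row≡ : ∀ i → lookup V i ≡ false ∷ init (lookup W i)
  row≡ i = lookup-map i (λ row → false ∷ init row) W
  first : ∀ i → V [ i , zero ] ≡ false
  first i = cong (λ v → lookup v zero) (row≡ i)
  rest : ∀ i p → V [ i , suc p ] ≡ W [ i , inject₁ p ]
  rest i p = trans (cong (λ v → lookup v (suc p)) (row≡ i)) (lookup-init (lookup W i) p)
  V⊨W : V ⊨ W
  V⊨W = shift⇒⊨ {A = V} {B = W} rest
  V≤ : V ≤ₐ window G (suc w) j
  V≤ i zero    = false-≤ (first i)
  V≤ i (suc p) = subst₂ Bool._≤_ (sym (rest i p))
    (sym (⊨⇒shift {A = window G (suc w) j} {B = window G (suc w) (suc j)} (window-⊨ G w j) i p)) (W≤ i (inject₁ p))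
  rows′ : ∀ i → ∣ lookup V i ∣ ≤ 1
  rows′ i = ≤-trans (≤-reflexive (cong ∣_∣ (row≡ i))) (≤-trans (m≤m+n ∣ init (lookup W i) ∣ (bit (last (lookup W i))))
    (≤-trans (≤-reflexive (sym (trans (cong ∣_∣ (proj₂ (proj₂ (initLast (lookup W i))))) (∣∷ʳ∣ (init (lookup W i)) (last (lookup W i)))))) (rows≤ i)))
  cols′ : ∀ p → ∣ column V p ∣ ≤ l
  cols′ zero    = ≤-trans (≤-reflexive (none⇒∣∣≡0 (column V zero) λ i → trans (lookup-column V zero i) (first i))) z≤n
  cols′ (suc p) = subst (λ u → ∣ u ∣ ≤ l) (lookup-ext {u = column W (inject₁ p)} {v = column V (suc p)} λ i →
    trans (lookup-column W (inject₁ p) i) (trans (sym (rest i p)) (sym (lookup-column V (suc p) i)))) (cols≤ (inject₁ p))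

toList-equal : ∀ {r} {U V : Vec ℕ r} → toList U ≡ toList V → U ≡ V
toList-equal {U = U} {V} eq = trans (sym (cast-is-id refl U)) (toList-injective refl U V eq)

-- The local function of readPred has no name outside its definition.  Applied
-- to variables only, as it is after the abstraction of suc k, W and suc in
-- readPred-afterRead, it is the unique solution for the body of readPredFrom.
afterRead : ∀ {V k r} → V → Prog V k r → Σ[ q ∈ ℕ ] Prog V k q
afterRead v (read _ _ c) with c v
... | bind {q} p _ = q , p
... | p            = _ , p
afterRead v p = _ , p

mutual

  readPredFrom : ∀ {V k} → V → V → V → V → V → V → Vec V k → ∀ {m} → (Fin m → Fin k) → Prog V k m
  readPredFrom = _

  readPred-afterRead : ∀ {V k} (n l ω 0# 1# j : V) (W : Vec V (suc k)) →
    afterRead n (Program.readPred n l ω 0# 1# j W) ≡ (k , readPredFrom n l ω 0# 1# j W (λ i → suc i))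
  readPred-afterRead {k = k} n l ω 0# 1# j W with suc k | W | (λ i → Fin.suc {k} i)
  ... | _ | _ | _ = refl

readPredFrom-yields : ∀ {k} (n l ω z o j : ℕ) (W : Vec ℕ k) (s : Store k) m (f : Fin m → Fin k) →
  Yields (readPredFrom n l ω z o j W f) s (tabulate λ i → s pred[ f i ] (j ∷ toList W))
readPredFrom-yields n l ω z o j W s zero    f = ret-yields
readPredFrom-yields n l ω z o j W s (suc m) f = read-ends (bind-yields
  (readPredFrom-yields n l ω z o j W s m (λ i → f (suc i))) ret-yields)

-- Correctness of the program

module Run {k n : ℕ} (G : Array k n) (l w : ℕ) where

  private
    ω : ℕ
    ω = suc w

  open Program {ℕ} {k} n l ω 0 1

  count-yields : ∀ {s} (W : Vec ℕ k) i →
    Yields (sumRows λ i′ → if≡ (lookup W i′) (lookup W i) (ret (1 ∷ [])) (ret (0 ∷ []))) s (occurrences W (lookup W i) ∷ [])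
  count-yields {s} W i = foldr-yields (λ i′ → bit (lookup W i′ ≡ᵇ lookup W i))
    (λ i′ rest v yields → bind-yields yields (bind-yields (one i′) (add-ends (ends (refl , refl)))))
    ret-yields (allFin k)
    where
    one : ∀ i′ → Yields (if≡ (lookup W i′) (lookup W i) (ret (1 ∷ [])) (ret (0 ∷ []))) s (bit (lookup W i′ ≡ᵇ lookup W i) ∷ [])
    one i′ = if≡-ends
      (λ eq → ret-ends (cong (λ b → bit b ∷ []) (sym (trans (cong (_≡ᵇ lookup W i) eq) (≡ᵇ-refl (lookup W i)))) , refl))
      (λ ne → ret-ends (cong (λ b → bit b ∷ []) (sym (≢⇒≡ᵇ-false ne)) , refl))

  Capacity : Vec ℕ k → Fin k → Set
  Capacity W i = lookup W i ≢ 0 → occurrences W (lookup W i) ≤ l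

  -- The program checks only those columns in which some row has its entry; the remaining ones are
  -- empty. At most one entry per row is built into the words.
  capacity⇒feasible : ∀ W → (∀ i → Capacity W i) → Feasible {ω = ω} l (decode W)
  capacity⇒feasible W cap = decode-unique W , column≤
    where
    column≤ : ∀ p → ∣ column (decode {m = ω} W) p ∣ ≤ l
    column≤ p with ∣∣-positive (column (decode {m = ω} W) p)
    ... | inj₁ h       = ≤-trans (≤-reflexive h) z≤n
    ... | inj₂ (i , h) = subst (_≤ l) (trans (cong (occurrences W) (sym W≡)) (occurrences-column W p))
                           (cap i (λ eq → contradiction (trans W≡ eq) λ ()))
      where
      W≡ : suc (toℕ p) ≡ lookup W i
      W≡ = ≡ᵇ-true (trans (sym (lookup-decode {m = ω} W i p)) (trans (sym (lookup-column (decode {m = ω} W) p i)) h))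

  feasible⇒capacity : ∀ W → InBox ω W → Feasible {ω = ω} l (decode W) → ∀ i → Capacity W i
  feasible⇒capacity W W≤ (_ , cols) i W≢0 with lookup W i | W≤ i
  ... | zero  | _ = contradiction refl W≢0
  ... | suc p | p<ω = subst (_≤ l)
    (trans (sym (occurrences-column W (fromℕ< p<ω))) (cong (λ x → occurrences W (suc x)) (toℕ-fromℕ< p<ω))) (cols (fromℕ< p<ω))

  ifFeasible-ends : ∀ {r s} W {accept reject : Prog ℕ k r} {Q : Post k r} → InBox ω W →
    (Feasible {ω = ω} l (decode W) → Ends accept s Q) → (¬ Feasible {ω = ω} l (decode W) → Ends reject s Q) →
    Ends (ifFeasible W accept reject) s Q
  ifFeasible-ends W W≤ acc rej = foldr-guard (Capacity W)
    (λ i next yes no → if≡-ends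
      (λ W≡0 → yes (λ W≢0 → contradiction W≡0 W≢0))
      (λ W≢0 → bind-yields (count-yields W i) (if≤-ends (λ h → yes (λ _ → h)) (λ h → no (λ c → h (c W≢0))))))
    (allFin k)
    (λ cap → acc (capacity⇒feasible W (λ i → cap i (∈-allFin i))))
    (λ i ¬cap → rej (λ feas → ¬cap (feasible⇒capacity W W≤ feas i)))

  Available : ℕ → Vec ℕ k → Fin k → Set
  Available j W i = lookup W i ≢ 0 → padded ω (lookup G i) (j + lookup W i) ≡ true

  available⇒≤ : ∀ j W → (∀ i → Available j W i) → decode W ≤ₐ window G ω j
  available⇒≤ j W av i p = true-≤ λ h →
    let W≡ = ≡ᵇ-true (trans (sym (lookup-decode {m = ω} W i p)) h) in
    trans (lookup-window G ω j i p) (trans (cong (λ x → padded ω (lookup G i) (j + x)) W≡)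
      (av i (λ eq → contradiction (trans W≡ eq) λ ())))

  ≤⇒available : ∀ j W → InBox ω W → decode W ≤ₐ window G ω j → ∀ i → Available j W i
  ≤⇒available j W W≤ le i W≢0 = go (lookup W i) refl (W≤ i)
    where
    go : ∀ c → lookup W i ≡ c → c ≤ ω → padded ω (lookup G i) (j + lookup W i) ≡ true
    go zero    eq _   = contradiction eq W≢0
    go (suc c) eq c<ω = trans (cong (λ x → padded ω (lookup G i) (j + x)) (trans eq (cong suc (sym (toℕ-fromℕ< c<ω)))))
      (trans (sym (lookup-window G ω j i (fromℕ< c<ω))) (≤-true (le i (fromℕ< c<ω))
        (trans (lookup-decode {m = ω} W i (fromℕ< c<ω)) (trans (cong₂ _≡ᵇ_ (cong suc (toℕ-fromℕ< c<ω)) eq) (≡ᵇ-refl c)))))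

  bit≡0 : ∀ {b} → bit b ≡ 0 → b ≢ true
  bit≡0 {false} _ ()

  bit≢0 : ∀ {b} → bit b ≢ 0 → b ≡ true
  bit≢0 {true}  _ = refl
  bit≢0 {false} h = contradiction refl h

  if𝓕-ends : ∀ {r s} j W {accept reject : Prog ℕ k r} {Q : Post k r} → Loaded G ω s → j ≤ n → InBox ω W →
    (𝓕 {ω = ω} G l j (decode W) → Ends accept s Q) → (¬ 𝓕 {ω = ω} G l j (decode W) → Ends reject s Q) →
    Ends (if𝓕 j W accept reject) s Q
  if𝓕-ends {s = s} j W loaded j≤n W≤ acc rej = foldr-guard (Available j W)
    (λ i next yes no → if≡-ends
      (λ W≡0 → yes (λ W≢0 → contradiction W≡0 W≢0))
      (λ W≢0 → add-ends (read-ends (if≡-ends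
        (λ g≡0 → no (λ av → bit≡0 (trans (sym (entry≡ i W≢0)) g≡0) (av W≢0)))
        (λ g≢0 → yes (λ _ → bit≢0 (λ eq → g≢0 (trans (entry≡ i W≢0) eq))))))))
    (allFin k)
    (λ av → let le = available⇒≤ j W (λ i → av i (∈-allFin i)) in
      ifFeasible-ends W W≤ (λ feas → acc (le , feas)) (λ ¬feas → rej (λ W∈ → ¬feas (proj₂ W∈))))
    (λ i ¬av → rej (λ W∈ → ¬av (≤⇒available j W W≤ (proj₁ W∈) i)))
    where
    entry≡ : ∀ i → lookup W i ≢ 0 → s G[ i ] (j + lookup W i ∷ []) ≡ bit (padded ω (lookup G i) (j + lookup W i))
    -- A nonzero word keeps the index positive, and `j ≤ n` with a word at most `ω` keeps it within
    -- the loaded columns.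
    entry≡ i W≢0 = loaded i (j + lookup W i) (≤-trans (n≢0⇒n>0 W≢0) (m≤n+m _ j)) (+-mono-≤ j≤n (W≤ i))

  -- Instead of multiplying bits, the program adds the entry of `G` for exactly those rows whose
  -- word is `ω`, that is, whose entry is in the last column.
  inner-yields : ∀ {s j} (W : Vec ℕ k) → Loaded G ω s → j < n →
    Yields (inner (suc j) W) s (⟨ map last (decode {m = ω} W) , columnAt G (+ suc j) ⟩ ∷ [])
  inner-yields {s} {j} W loaded j<n = subst (λ x → Yields (inner (suc j) W) s (x ∷ []))
    (sumOver-tabulate (λ i → i) value (zipWith (λ a b → bit a * bit b) (map last (decode W)) (columnAt G (+ suc j)))
      (λ i → trans (product i) (sym (lookup-zipWith (λ a b → bit a * bit b) i (map last (decode W)) (columnAt G (+ suc j))))))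
    (foldr-yields value
      (λ i rest v yields → bind-yields yields (bind-yields (one i) (add-ends (ends (refl , refl)))))
      ret-yields (allFin k))
    where
    value : Fin k → ℕ
    value i = if lookup W i ≡ᵇ ω then s G[ i ] (suc j + ω ∷ []) else 0
    one : ∀ i → Yields (if≡ (lookup W i) ω (add (suc j) ω λ c → read G[ i ] (c ∷ []) λ g → ret (g ∷ [])) (ret (0 ∷ []))) s (value i ∷ [])
    one i = if≡-ends
      (λ eq → add-ends (read-ends (ret-ends (sym (cong (λ b → (if b then s G[ i ] (suc j + ω ∷ []) else 0) ∷ []) (trans (cong (_≡ᵇ ω) eq) (≡ᵇ-refl ω))) , refl))))
      (λ ne → ret-ends (sym (cong (λ b → (if b then s G[ i ] (suc j + ω ∷ []) else 0) ∷ []) (≢⇒≡ᵇ-false ne)) , refl))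
    stored : ∀ i → s G[ i ] (suc j + ω ∷ []) ≡ bit (at (lookup G i) j)
    stored i = trans (loaded i (suc j + ω) (s≤s z≤n) (+-monoˡ-≤ ω j<n))
      (cong bit (trans (cong (padded ω (lookup G i)) (+-comm (suc j) ω)) (padded-at ω (lookup G i) j)))
    product : ∀ i → value i ≡ bit (lookup (map last (decode {m = ω} W)) i) * bit (lookup (columnAt G (+ suc j)) i)
    product i rewrite last-decode {m = w} W i | lookup-columnAt G j i | stored i | ≡ᵇ-sym (lookup W i) ω with ω ≡ᵇ lookup W i
    ... | true  = sym (+-identityʳ _)
    ... | false = refl

  before-yields : ∀ {m s} (ps bs : Vec ℕ m) → Yields (before ps bs) s (predecessor ω bs ps)
  before-yields []       []       = ret-yields
  before-yields (p ∷ ps) (b ∷ bs) = bind-yields (before-yields ps bs) (if≡-ends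
    (λ p≡0 → ret-ends (sym (cong (_∷ predecessor ω bs ps) (shift-keep {ω} b (inj₁ p≡0))) , refl))
    (λ p≢0 → if≡-ends
      (λ p≡ω → ret-ends (sym (cong (_∷ predecessor ω bs ps) (shift-keep {ω} b (inj₂ p≡ω))) , refl))
      (λ p≢ω → add-ends (ret-ends (cong (_∷ predecessor ω bs ps) (trans (+-comm p 1) (sym (shift-move {ω} b p≢0 p≢ω))) , refl)))))

  -- The flag stands in for a least value: `best` means nothing until a candidate has been met.
  -- `Best` describes the state and `Seen` a single window, which makes them the frame and the goals
  -- of a nested loop.
  module Search (s : Store k) (j : ℕ) (Candidate : Vec ℕ k → Set) where

    value : Vec ℕ k → ℕ
    value W = s MIS (j ∷ toList W)

    Best : Post k (2 + k)
    Best (found ∷ best ∷ W*) s′ = s′ ≡ s × (found ≡ 0 ⊎ (found ≡ 1 × Candidate W* × best ≡ value W*))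

    Seen : Vec ℕ k → Post k (2 + k)
    Seen W (found ∷ best ∷ W*) _ = Candidate W → found ≡ 1 × value W ≤ best

    Step : Vec ℕ k → Vec ℕ (2 + k) → Store k → Post k (2 + k)
    Step W ys s′ ys′ s″ = Best ys′ s″ × Seen W ys′ s″ × (∀ V → Seen V ys s′ → Seen V ys′ s″)

    none-best : Best none s
    none-best = refl , inj₁ refl

    skip : ∀ {W ys s′} → Best ys s′ → ¬ Candidate W → Ends (ret ys) s′ (Step W ys s′)
    skip {ys = _ ∷ _ ∷ _} best ¬cand = ret-ends (best , (λ cand → contradiction cand ¬cand) , λ _ h → h)

    improve-ends : ∀ {W ys s′} → Best ys s′ → Candidate W → Ends (improve j W ys) s′ (Step W ys s′)
    improve-ends {W} {found ∷ best ∷ W*} (refl , state) cand = read-ends (if≡-ends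
      (λ found≡0 → ret-ends
        ((refl , inj₂ (refl , cand , refl)) , (λ _ → refl , ≤-refl) ,
         -- Had a candidate been seen before, the flag would be 1.
         λ V seen c → contradiction (trans (sym (proj₁ (seen c))) found≡0) λ ()))
      (λ found≢0 → if≤-ends
        (λ v≤best → ret-ends ((refl , state) , (λ _ → found≡1 state found≢0 , v≤best) , λ _ h → h))
        (λ v≰best → ret-ends
          ((refl , inj₂ (refl , cand , refl)) , (λ _ → refl , ≤-refl) ,
           λ V seen c → refl , ≤-trans (proj₂ (seen c)) (<⇒≤ (≰⇒> v≰best))))))
      where
      found≡1 : ∀ {P : Set} → found ≡ 0 ⊎ (found ≡ 1 × P) → found ≢ 0 → found ≡ 1
      found≡1 (inj₁ eq)       ne = contradiction eq ne
      found≡1 (inj₂ (eq , _)) _  = eq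

    Maximum : Vec ℕ k → Set
    Maximum W* = Candidate W* × (∀ V → Candidate V → value V ≤ value W*)

    -- The candidate `V` rules out the state in which nothing has been found.
    best-maximum : ∀ {found best W* s′} → Best (found ∷ best ∷ W*) s′ → (∀ V → Candidate V → Seen V (found ∷ best ∷ W*) s′) →
      ∀ V → Candidate V → s′ ≡ s × best ≡ value W* × Maximum W*
    best-maximum (s≡ , inj₁ refl) seen V cand = contradiction (proj₁ (seen V cand cand)) λ ()
    best-maximum (s≡ , inj₂ (_ , cand* , best≡)) seen _ _ =
      s≡ , best≡ , cand* , λ V cand → ≤-trans (proj₂ (seen V cand cand)) (≤-reflexive best≡)

  forWindows-ends : ∀ {q} {X : Set} (f : Vec ℕ k → X) {xs : Vec ℕ q} {body} {s : Store k} (Frame : Post k q) (Goal : X → Post k q) →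
    (∀ W → InBox ω W → ∀ ys s′ → Frame ys s′ →
      Ends (body W ys) s′ (λ ys′ s″ → Frame ys′ s″ × Goal (f W) ys′ s″ × (∀ x → Goal x ys s′ → Goal x ys′ s″))) →
    Frame xs s →
    Ends (forWindows xs body) s (λ ys′ s″ →
      Frame ys′ s″ × (∀ W → InBox ω W → Goal (f W) ys′ s″) × (∀ x → Goal x xs s → Goal x ys′ s″))
  forWindows-ends f Frame Goal step frame = add-1-ends (ends-mono
    (λ _ _ (fr , goal , keep) → fr , (λ W W≤ → goal W (λ i → s≤s (W≤ i))) , keep)
    (forVec-ends n l ω 0 1 k (suc ω) f Frame Goal (λ W W< → step W (λ i → ≤-pred (W< i))) frame))

  -- Initialisation and the forward pass

  Base : Store k → Set
  Base s = s MIS (0 ∷ toList (replicate k 0)) ≡ 0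

  Zeroed : ℕ → Store k → Set
  Zeroed m s = ∀ j → j < m → ∀ (W : Vec ℕ k) → InBox ω W → Feasible {ω = ω} l (decode W) → s MIS (suc j ∷ toList W) ≡ 0

  -- What remains of `Zeroed` through the forward pass, which overwrites only cells of windows in
  -- `𝓕`.
  Skipped : Store k → Set
  Skipped s = ∀ j → j < n → ∀ (W : Vec ℕ k) → InBox ω W → Feasible {ω = ω} l (decode W) → ¬ 𝓕 {ω = ω} G l (suc j) (decode W) →
    s MIS (suc j ∷ toList W) ≡ 0

  loaded-write : ∀ (s : Store k) is v → Loaded G ω s → Loaded G ω (s [ MIS , is ]≔ v)
  loaded-write s is v loaded i c c≥ c≤ = trans (write-other s MIS is v (λ ())) (loaded i c c≥ c≤)

  initialise-ends : ∀ {s} → Loaded G ω s → Ends initialise s (λ _ s′ → Loaded G ω s′ × Base s′ × Zeroed n s′)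
  initialise-ends {s} loaded = write-ends (for-ends (λ i _ s′ → Loaded G ω s′ × Base s′ × Zeroed i s′)
    (loaded-write s (0 ∷ toList (replicate k 0)) 0 loaded , write-same s MIS (0 ∷ toList (replicate k 0)) 0 , λ _ ())
    (λ i i<n _ s′ (loaded′ , base′ , zeroed′) → add-1-ends (ends-mono
      (λ _ s″ ((loaded″ , base″) , goal , keep) → loaded″ , base″ , λ j j<1+i W W≤ feas →
        extend s″ i j j<1+i W feas (goal W W≤) (λ j<i → keep (suc j , W) (λ _ → zeroed′ j j<i W W≤ feas)))
      (forWindows-ends (λ W → suc i , W) Frame Goal
        (λ W W≤ _ s₁ (loaded₁ , base₁) → ifFeasible-ends W W≤
          (λ feas → write-ends (ret-ends
            -- Every write here puts 0, so the earlier zeros survive even if cells coincide.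
            ((loaded-write s₁ (suc i ∷ toList W) 0 loaded₁ , write-keeps s₁ MIS (suc i ∷ toList W) 0 (λ _ → refl) base₁) ,
             (λ _ → write-same s₁ MIS (suc i ∷ toList W) 0) ,
             (λ x goal feas → write-keeps s₁ MIS (suc i ∷ toList W) 0 (λ _ → refl) (goal feas)))))
          (λ ¬feas → ret-ends ((loaded₁ , base₁) , (λ feas → contradiction feas ¬feas) , λ _ h → h)))
        (loaded′ , base′)))))
    where
    Frame : Post k 0
    Frame _ s′ = Loaded G ω s′ × Base s′
    Goal : ℕ × Vec ℕ k → Post k 0
    Goal (j , W) _ s′ = Feasible {ω = ω} l (decode W) → s′ MIS (j ∷ toList W) ≡ 0
    extend : ∀ (s″ : Store k) i j → j < suc i → ∀ W → Feasible {ω = ω} l (decode W) →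
      Goal (suc i , W) [] s″ → (j < i → Goal (suc j , W) [] s″) → s″ MIS (suc j ∷ toList W) ≡ 0
    extend s″ i j j<1+i W feas new old with j ℕ.≟ i
    ... | yes refl = new feas
    ... | no  j≢i  = old (≤∧≢⇒< (≤-pred j<1+i) j≢i) feas

  -- `choice` and `update` for a single window, in words. On level `suc j` only the cells of `W`
  -- itself are involved, so the updates of other windows on that level leave it intact.
  record Updated (s : Store k) (j : ℕ) (W : Vec ℕ k) : Set where
    field
      W*       : Vec ℕ k
      inBox    : InBox ω W*
      feasible : 𝓕 {ω = ω} G l j (decode W*)
      linked   : decode {m = ω} W* ⊨ decode W
      maximal  : ∀ (V : Vec ℕ k) → InBox ω V → 𝓕 {ω = ω} G l j (decode V) → decode {m = ω} V ⊨ decode W →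
                 s MIS (j ∷ toList V) ≤ s MIS (j ∷ toList W*)
      value    : s MIS (suc j ∷ toList W) ≡ ⟨ map last (decode {m = ω} W) , columnAt G (+ suc j) ⟩ + s MIS (j ∷ toList W*)
      stored   : ∀ a → s pred[ a ] (suc j ∷ toList W) ≡ lookup W* a

  Row : Store k → ℕ → Vec ℕ k → Set
  Row s j W = 𝓕 {ω = ω} G l (suc j) (decode W) → Updated s j W

  -- The update of a window writes `MIS` and all the arrays `pred[ a ]` at one common index list.
  -- `G` is listed separately so that its cells are preserved without comparing indices.
  SameOff : List ℕ → Store k → Store k → Set
  SameOff is s s′ = (∀ a js → s′ G[ a ] js ≡ s G[ a ] js) × (∀ x js → js ≢ is → s′ x js ≡ s x js)

  -- The values of the predecessors are on level `j ≤ i` and the writes on level `suc i`, so only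
  -- the cells of `V` itself have to be told apart from those written.
  row-sameOff : ∀ {s s′ i} {W : Vec ℕ k} → SameOff (suc i ∷ toList W) s s′ → ∀ {j} {V : Vec ℕ k} → j ≤ i →
    suc j ∷ toList V ≢ suc i ∷ toList W → Row s j V → Row s′ j V
  row-sameOff {s} {s′} {i} {W} (_ , same) {j} {V} j≤i ne row V∈ = record
    { W* = W* ; inBox = inBox ; feasible = feasible ; linked = linked
    ; maximal = λ U U≤ U∈ U⊨V → subst₂ _≤_ (sym (old U)) (sym (old W*)) (maximal U U≤ U∈ U⊨V)
    ; value = trans (same MIS (suc j ∷ toList V) ne) (trans value (cong (λ x → ⟨ map last (decode {m = ω} V) , columnAt G (+ suc j) ⟩ + x) (sym (old W*))))
    ; stored = λ a → trans (same pred[ a ] (suc j ∷ toList V) ne) (stored a)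
    }
    where
    open Updated (row V∈)
    old : ∀ (U : Vec ℕ k) → s′ MIS (j ∷ toList U) ≡ s MIS (j ∷ toList U)
    old U = same MIS (j ∷ toList U) λ eq → <⇒≢ (s≤s j≤i) (List.∷-injectiveˡ eq)

  record Forward (i : ℕ) (s : Store k) : Set where
    field
      loaded  : Loaded G ω s
      base    : Base s
      skipped : Skipped s
      updated : ∀ j → j < i → ∀ W → InBox ω W → Row s j W

  forward-sameOff : ∀ {s s′ i} {W : Vec ℕ k} → SameOff (suc i ∷ toList W) s s′ → 𝓕 {ω = ω} G l (suc i) (decode W) →
    Forward i s → Forward i s′
  forward-sameOff {s} {s′} {i} {W} same@(sameG , sameOff) W∈ fw = record
    { loaded  = λ a c c≥ c≤ → trans (sameG a (c ∷ [])) (loaded a c c≥ c≤)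
    ; base    = trans (sameOff MIS (0 ∷ toList (replicate k 0)) λ ()) base
    -- The window written lies in `𝓕`, so its cell is none of those in `Skipped`.
    ; skipped = λ j j<n V V≤ feas V∉ → trans (sameOff MIS (suc j ∷ toList V) λ eq →
        V∉ (subst₂ (λ x U → 𝓕 {ω = ω} G l x (decode U)) (sym (List.∷-injectiveˡ eq)) (sym (toList-equal (List.∷-injectiveʳ eq))) W∈))
        (skipped j j<n V V≤ feas V∉)
    ; updated = λ j j<i V V≤ → row-sameOff same (<⇒≤ j<i) (λ eq → <⇒≢ j<i (suc-injective (List.∷-injectiveˡ eq))) (updated j j<i V V≤)
    }
    where
    open Forward fw

  Candidate : ℕ → Vec ℕ k → Vec ℕ k → Set
  Candidate i W V = InBox ω V × 𝓕 {ω = ω} G l i (decode V) × decode {m = ω} V ⊨ decode W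

  candidate : ∀ i {W} → 𝓕 {ω = ω} G l (suc i) (decode W) → Σ[ V ∈ Vec ℕ k ] Candidate i W V
  candidate i {W} W∈ with 𝓕-predecessor G l w i (decode W) W∈
  ... | V , V∈ , V⊨W = encode V , encode-InBox V , subst (𝓕 G l i) (sym V≡) V∈ , subst (_⊨ decode W) (sym V≡) V⊨W
    where
    V≡ : decode (encode V) ≡ V
    V≡ = decode-encode V (proj₁ (proj₂ V∈))

  Found : Store k → ℕ → Vec ℕ k → Post k (2 + k)
  Found s i W (_ ∷ best ∷ W*) s′ = s′ ≡ s × best ≡ value W* × Maximum W*
    where open Search s i (Candidate i W)

  choose-ends : ∀ {s i} {W : Vec ℕ k} → Loaded G ω s → i < n → InBox ω W → 𝓕 {ω = ω} G l (suc i) (decode W) →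
    Ends (forVec k 2 none λ bs best → bind (before W bs) λ W* → if𝓕 i W* (improve i W* best) (ret best)) s (Found s i W)
  choose-ends {s} {i} {W} loaded i<n W≤ W∈ = ends-mono
    (λ { (found ∷ best ∷ W*) s′ (frame , seen , _) →
      -- Every candidate arises from some bits and so has been seen; `candidate` supplies the one
      -- that must exist.
      best-maximum frame
        (λ V cand@(V≤ , _ , V⊨W) → let bs , bs<2 , eq = ⊨-predecessor W W≤ V V≤ V⊨W in
          subst (λ U → Seen U (found ∷ best ∷ W*) s′) eq (seen bs bs<2))
        (proj₁ (candidate i W∈)) (proj₂ (candidate i W∈)) })
    (forVec-ends n l ω 0 1 k 2 (λ bs → predecessor ω bs W) Best Seen step none-best)
    where
    open Search s i (Candidate i W)
    step : ∀ bs → (∀ a → lookup bs a < 2) → ∀ ys s′ → Best ys s′ →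
      Ends (bind (before W bs) λ W* → if𝓕 i W* (improve i W* ys) (ret ys)) s′ (Step (predecessor ω bs W) ys s′)
    step bs bs<2 ys@(_ ∷ _ ∷ _) s′ best@(refl , _) = bind-yields (before-yields W bs)
      (if𝓕-ends i (predecessor ω bs W) loaded (<⇒≤ i<n) V≤
        (λ V∈ → improve-ends best (V≤ , V∈ , predecessor-⊨ W W≤ bs bs<2))
        (λ V∉ → skip best (λ cand → V∉ (proj₁ (proj₂ cand)))))
      where
      V≤ : InBox ω (predecessor ω bs W)
      V≤ = predecessor-InBox W W≤ bs bs<2

  Written : Store k → ℕ → Vec ℕ k → ℕ → Vec ℕ k → Store k → Set
  Written s i W m W* s′ = SameOff (suc i ∷ toList W) s s′ × s′ MIS (suc i ∷ toList W) ≡ m ×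
    (∀ a → s′ pred[ a ] (suc i ∷ toList W) ≡ lookup W* a)

  write-row-ends : ∀ (s : Store k) i (W : Vec ℕ k) m W* → Ends
    (write MIS (suc i ∷ toList W) m (rows (λ a → write pred[ a ] (suc i ∷ toList W) (lookup W* a)) (ret []))) s
    (λ _ → Written s i W m W*)
  write-row-ends s i W m W* = write-ends (ends-mono
    (λ _ s′ (written , _ , other) →
      ((λ a js → trans (other G[ a ] js λ _ ()) (write-other s MIS is m λ ())) ,
       (λ x js ne → trans (other x js λ _ (_ , eq) → ne (sym eq)) (write-other s MIS is m λ (_ , eq) → ne (sym eq)))) ,
      trans (other MIS is λ _ ()) (write-same s MIS is m) ,
      (λ a → written a (∈-allFin a)))
    (foldr-write pred[_] is (lookup W*) (λ { refl → refl }) (λ a next s Q h → write-ends h) (allFin k) (s [ MIS , is ]≔ m)))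
    where
    is : List ℕ
    is = suc i ∷ toList W

  Progress : ℕ → Vec ℕ k → Store k → Store k → Set
  Progress i W s s′ = Forward i s′ × Row s′ i W × (∀ V → Row s i V → Row s′ i V)

  written-progress : ∀ {s s′ s₁ i W found best W*} → Forward i s → 𝓕 {ω = ω} G l (suc i) (decode W) →
    Found s i W (found ∷ best ∷ W*) s₁ →
    Written s i W (⟨ map last (decode {m = ω} W) , columnAt G (+ suc i) ⟩ + best) W* s′ → Progress i W s s′
  written-progress {s} {s′} {i = i} {W} {W* = W*} fw W∈ (_ , best≡ , (W*≤ , W*∈ , W*⊨W) , max) (same , mis≡ , pred≡) =
    forward-sameOff same W∈ fw , row , keep
    where
    old : ∀ (U : Vec ℕ k) → s′ MIS (i ∷ toList U) ≡ s MIS (i ∷ toList U)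
    old U = proj₂ same MIS (i ∷ toList U) λ eq → <⇒≢ ≤-refl (List.∷-injectiveˡ eq)
    row : Row s′ i W
    row _ = record
      { W* = W* ; inBox = W*≤ ; feasible = W*∈ ; linked = W*⊨W
      ; maximal = λ V V≤ V∈ V⊨W → subst₂ _≤_ (sym (old V)) (sym (old W*)) (max V (V≤ , V∈ , V⊨W))
      ; value   = trans mis≡ (cong (λ x → ⟨ map last (decode {m = ω} W) , columnAt G (+ suc i) ⟩ + x) (trans best≡ (sym (old W*))))
      ; stored  = pred≡
      }
    keep : ∀ V → Row s i V → Row s′ i V
    keep V rowV with ≡-dec ℕ._≟_ V W
    ... | yes refl = row
    ... | no  V≢W  = row-sameOff same ≤-refl (λ eq → V≢W (toList-equal (List.∷-injectiveʳ eq))) rowV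

  forward-ends : ∀ {s} → Loaded G ω s → Base s → Zeroed n s → Ends forward s (λ _ → Forward n)
  forward-ends loaded base zeroed = for-ends (λ i _ → Forward i)
    (record { loaded = loaded ; base = base ; skipped = λ j j<n W W≤ feas _ → zeroed j j<n W W≤ feas ; updated = λ _ () })
    (λ i i<n _ s′ fw′ → add-1-ends (ends-mono
      (λ _ s″ (fw″ , rows″ , _) → record
        { loaded = Forward.loaded fw″ ; base = Forward.base fw″ ; skipped = Forward.skipped fw″
        ; updated = λ j j<1+i W W≤ → extend i j W j<1+i fw″ (rows″ W W≤) W≤ })
      (forWindows-ends (λ W → W) (λ _ → Forward i) (λ W _ s → Row s i W)
        (λ W W≤ _ s fw → if𝓕-ends (suc i) W (Forward.loaded fw) i<n W≤
          (λ W∈ → bind-ends (add-ends (ends-mono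
            (λ { (found ∷ best ∷ W*) s₁ found*@(refl , _) →
              bind-yields (inner-yields W (Forward.loaded fw) i<n) (add-ends (ends-mono
                (λ _ _ → written-progress {s₁ = s₁} {found = found} fw W∈ found*) (write-row-ends s i W _ W*))) })
            (choose-ends (Forward.loaded fw) i<n W≤ W∈))))
          (λ W∉ → ret-ends (fw , (λ W∈ → contradiction W∈ W∉) , λ _ h → h)))
        fw′)))
    where
    extend : ∀ {s} i j W → j < suc i → Forward i s → Row s i W → InBox ω W → Row s j W
    extend i j W j<1+i fw row W≤ with j ℕ.≟ i
    ... | yes refl = row
    ... | no  j≢i  = Forward.updated fw j (≤∧≢⇒< (≤-pred j<1+i) j≢i) W W≤

  -- Tables and retrieval from the final store

  predWords : Store k → ℕ → Vec ℕ k → Vec ℕ k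
  predWords s j W = tabulate λ a → s pred[ a ] (j ∷ toList W)

  module _ {s : Store k} (fw : Forward n s) where
    open Forward fw

    predWords-updated : ∀ {j W} (u : Updated s j W) → predWords s (suc j) W ≡ Updated.W* u
    predWords-updated u = lookup-ext λ a → trans (lookup∘tabulate _ a) (Updated.stored u a)

    encoded-row : ∀ j → j < n → ∀ W → 𝓕 {ω = ω} G l (suc j) W → Updated s j (encode W)
    encoded-row j j<n W W∈ = updated j j<n (encode W) (encode-InBox W) (subst (𝓕 G l (suc j)) (sym (decode-encode W (proj₁ (proj₂ W∈)))) W∈)

    -- `encode` forgets all but the first entry of a row, but `Tables` constrains only feasible
    -- windows, on which `decode` undoes it.
    tables : Tables G l w
    tables = record
      { MIS     = λ j W → s MIS (j ∷ toList (encode W))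
      ; pred    = λ j W → decode (predWords s j (encode W))
      ; base    = trans (cong (λ W → s MIS (0 ∷ toList W)) encode-𝟎) base
      ; skipped = λ j j<n W feas W∉ → let W≡ = decode-encode W (proj₁ feas) in
          skipped j j<n (encode W) (encode-InBox W) (subst (Feasible l) (sym W≡) feas) (λ W∈ → W∉ (subst (𝓕 G l (suc j)) W≡ W∈))
      ; choice  = choice
      ; update  = update
      }
      where
      choice : ∀ j → j < n → ∀ W → 𝓕 G l (suc j) W →
        Maximizes (λ V → 𝓕 G l j V × V ⊨ W) (λ V → s MIS (j ∷ toList (encode V))) (decode {m = ω} (predWords s (suc j) (encode W)))
      choice j j<n W W∈ rewrite predWords-updated (encoded-row j j<n W W∈) =
        (feasible , subst (decode W* ⊨_) W≡ linked) , λ V (V∈ , V⊨W) →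
          let V≡ = decode-encode V (proj₁ (proj₂ V∈)) in
          subst (λ x → s MIS (j ∷ toList (encode V)) ≤ s MIS (j ∷ toList x)) (sym (encode-decode inBox))
            (maximal (encode V) (encode-InBox V) (subst (𝓕 G l j) (sym V≡) V∈) (subst₂ _⊨_ (sym V≡) (sym W≡) V⊨W))
        where
        open Updated (encoded-row j j<n W W∈)
        W≡ : decode (encode W) ≡ W
        W≡ = decode-encode W (proj₁ (proj₂ W∈))
      update : ∀ j → j < n → ∀ W → 𝓕 G l (suc j) W → s MIS (suc j ∷ toList (encode W)) ≡
        ⟨ map last W , columnAt G (+ suc j) ⟩ + s MIS (j ∷ toList (encode (decode {m = ω} (predWords s (suc j) (encode W)))))
      update j j<n W W∈ rewrite predWords-updated (encoded-row j j<n W W∈) = trans value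
        (cong₂ (λ U V → ⟨ map last U , columnAt G (+ suc j) ⟩ + s MIS (j ∷ toList V)) (decode-encode W (proj₁ (proj₂ W∈))) (sym (encode-decode inBox)))
        where open Updated (encoded-row j j<n W W∈)

    private
      R : (j : ℕ) → Array k ω → Array k j
      R = retrieve G l w (Tables.pred tables)

    -- The level is a variable with an equation because it is also instantiated with `n`, which is
    -- not a successor by form.
    top-column : ∀ {j j′} → j ≡ suc j′ → ∀ W a → at (lookup (R j (decode W)) a) j′ ≡ (ω ≡ᵇ lookup W a)
    top-column {j′ = j′} refl W a = begin
      at (lookup (R (suc j′) (decode W)) a) j′        ≡⟨ cong (λ v → at v j′) (lookup-retrieve G l w tables j′ (decode W) a) ⟩
      at (lookup (R j′ V) a ∷ʳ last (lookup (decode {m = ω} W) a)) j′ ≡⟨ at-∷ʳ-≡ (lookup (R j′ V) a) _ ⟩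
      last (lookup (decode {m = ω} W) a)              ≡⟨ lookup-map a last (decode {m = ω} W) ⟨
      lookup (map last (decode {m = ω} W)) a          ≡⟨ last-decode W a ⟩
      (ω ≡ᵇ lookup W a)                               ∎
      where
      open ≡-Reasoning
      V = Tables.pred tables (suc j′) (decode W)

    lower-columns : ∀ j W → InBox ω W → ∀ a t → t < j →
      at (lookup (R (suc j) (decode W)) a) t ≡ at (lookup (R j (decode (predWords s (suc j) W))) a) t
    lower-columns j W W≤ a t t<j = begin
      at (lookup (R (suc j) (decode W)) a) t                  ≡⟨ cong (λ v → at v t) (lookup-retrieve G l w tables j (decode W) a) ⟩
      at (lookup (R j V) a ∷ʳ last (lookup (decode {m = ω} W) a)) t   ≡⟨ at-∷ʳ-< (lookup (R j V) a) _ t<j ⟩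
      at (lookup (R j V) a) t                                 ≡⟨ cong (λ U → at (lookup (R j (decode (predWords s (suc j) U))) a) t) (encode-decode W≤) ⟩
      at (lookup (R j (decode (predWords s (suc j) W))) a) t  ∎
      where
      open ≡-Reasoning
      V = Tables.pred tables (suc j) (decode W)

    writeColumn-ends : ∀ (s₁ : Store k) j W → Ends (writeColumn j W) s₁ (λ _ s′ →
      (∀ a → s′ I[ a ] (j ∷ []) ≡ bit (ω ≡ᵇ lookup W a)) ×
      (∀ y js → (∀ a → ¬ (I[ a ] ≡ y × j ∷ [] ≡ js)) → s′ y js ≡ s₁ y js))
    writeColumn-ends s₁ j W = ends-mono
      (λ _ _ (written , _ , other) → (λ a → written a (∈-allFin a)) , other)
      (foldr-write I[_] (j ∷ []) (λ a → bit (ω ≡ᵇ lookup W a)) (λ { refl → refl })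
        (λ a next s₂ Q h → if≡-ends
          (λ eq → write-ends (subst (λ v → Ends next (s₂ [ I[ a ] , j ∷ [] ]≔ v) Q)
            (cong bit (trans (cong (ω ≡ᵇ_) eq) (≡ᵇ-refl ω))) h))
          (λ ne → write-ends (subst (λ v → Ends next (s₂ [ I[ a ] , j ∷ [] ]≔ v) Q)
            (cong bit (≢⇒≡ᵇ-false (λ eq → ne (sym eq)))) h)))
        (allFin k) s₁)

    -- The loop invariant of the traceback: after `i` iterations `W` is the window at time `suc j`.
    -- The array wanted is fixed by `W₀` while the loop knows only `W`; `linked` says that they
    -- agree on the columns up to that time. `kept` allows `pred` to be read as in `s`, although `I`
    -- has been written.
    record Retrieved (W₀ : Vec ℕ k) (i j : ℕ) (W : Vec ℕ k) (s′ : Store k) : Set where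
      field
        level    : i + suc j ≡ n
        inBox    : InBox ω W
        feasible : 𝓕 {ω = ω} G l (suc j) (decode W)
        linked   : ∀ a t → t < suc j → at (lookup (R n (decode W₀)) a) t ≡ at (lookup (R (suc j) (decode W)) a) t
        written  : ∀ a t → suc j ≤ suc t → t < n → s′ I[ a ] (suc t ∷ []) ≡ bit (at (lookup (R n (decode W₀)) a) t)
        kept     : ∀ a js → s′ pred[ a ] js ≡ s pred[ a ] js

    retrieved-start : ∀ {m W s′} → suc m ≡ n → InBox ω W → 𝓕 {ω = ω} G l n (decode W) →
      (∀ a → s′ I[ a ] (n ∷ []) ≡ bit (ω ≡ᵇ lookup W a)) →
      (∀ y js → (∀ a → ¬ (I[ a ] ≡ y × n ∷ [] ≡ js)) → s′ y js ≡ s y js) → Retrieved W 0 m W s′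
    retrieved-start {m} {W} {s′} eq W≤ W∈ new other = record
      { level = eq ; inBox = W≤ ; feasible = subst (λ x → 𝓕 {ω = ω} G l x (decode W)) (sym eq) W∈
      ; linked  = λ a t _ → same-level eq a t
      ; written = λ a t m<1+t t<n → written a t (≤-antisym t<n (≤-trans (≤-reflexive (sym eq)) m<1+t))
      ; kept    = λ a js → other pred[ a ] js λ _ ()
      }
      where
      same-level : ∀ {j j′} → j ≡ j′ → ∀ a t → at (lookup (R j′ (decode W)) a) t ≡ at (lookup (R j (decode W)) a) t
      same-level refl a t = refl
      written : ∀ a t → suc t ≡ n → s′ I[ a ] (suc t ∷ []) ≡ bit (at (lookup (R n (decode W)) a) t)
      written a t 1+t≡n = trans (cong (λ x → s′ I[ a ] (x ∷ [])) 1+t≡n) (trans (new a) (cong bit (sym (top-column (sym 1+t≡n) W a))))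

    retrieved-step : ∀ {W₀ i j W s₁ s′} → Retrieved W₀ i (suc j) W s₁ →
      let V = predWords s (suc (suc j)) W in
      (∀ a → s′ I[ a ] (suc j ∷ []) ≡ bit (ω ≡ᵇ lookup V a)) →
      (∀ y js → (∀ a → ¬ (I[ a ] ≡ y × suc j ∷ [] ≡ js)) → s′ y js ≡ s₁ y js) → Retrieved W₀ (suc i) j V s′
    retrieved-step {W₀} {i} {j} {W} {s₁} {s′} before-step new other = record
      { level    = trans (sym (+-suc i (suc j))) level
      ; inBox    = subst (InBox ω) (sym V≡) (Updated.inBox u)
      ; feasible = subst (λ U → 𝓕 {ω = ω} G l (suc j) (decode U)) (sym V≡) (Updated.feasible u)
      ; linked   = linked′
      ; written  = written′
      ; kept     = λ a js → trans (other pred[ a ] js λ _ ()) (kept a js)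
      }
      where
      open Retrieved before-step
      V : Vec ℕ k
      V = predWords s (suc (suc j)) W
      u : Updated s (suc j) W
      u = updated (suc j) (≤-trans (m≤n+m (suc (suc j)) i) (≤-reflexive level)) W inBox feasible
      V≡ : V ≡ Updated.W* u
      V≡ = predWords-updated u
      linked′ : ∀ a t → t < suc j → at (lookup (R n (decode W₀)) a) t ≡ at (lookup (R (suc j) (decode V)) a) t
      linked′ a t t<1+j = trans (linked a t (m<n⇒m<1+n t<1+j)) (lower-columns (suc j) W inBox a t t<1+j)
      written′ : ∀ a t → suc j ≤ suc t → t < n → s′ I[ a ] (suc t ∷ []) ≡ bit (at (lookup (R n (decode W₀)) a) t)
      written′ a t j≤t t<n with t ℕ.≟ j
      ... | yes refl = trans (new a) (cong bit (sym (trans (linked′ a t ≤-refl) (top-column {j′ = t} refl V a))))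
      ... | no  t≢j  = trans (other I[ a ] (suc t ∷ []) λ _ (_ , eq) → t≢j (sym (suc-injective (List.∷-injectiveˡ eq))))
                         (written a t (≤∧≢⇒< j≤t (λ eq → t≢j (sym (suc-injective eq)))) t<n)

    retrieved-result : ∀ {W₀ i W s′} → Retrieved W₀ i 0 W s′ → result k n s′ ≡ R n (decode W₀)
    retrieved-result {W₀} {s′ = s′} retrieved = array-ext λ a t → begin
      result k n s′ [ a , t ]                          ≡⟨ cong (λ v → lookup v t) (lookup∘tabulate _ a) ⟩
      lookup (tabulate λ t → not (s′ I[ a ] (suc (toℕ t) ∷ []) ≡ᵇ 0)) t ≡⟨ lookup∘tabulate _ t ⟩
      not (s′ I[ a ] (suc (toℕ t) ∷ []) ≡ᵇ 0)          ≡⟨ cong (λ x → not (x ≡ᵇ 0)) (written a (toℕ t) (s≤s z≤n) (toℕ<n t)) ⟩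
      not (bit (at (lookup (R n (decode W₀)) a) (toℕ t)) ≡ᵇ 0) ≡⟨ not-bit (at (lookup (R n (decode W₀)) a) (toℕ t)) ⟩
      at (lookup (R n (decode W₀)) a) (toℕ t)          ≡⟨ at-lookup (lookup (R n (decode W₀)) a) t ⟩
      R n (decode W₀) [ a , t ]                        ∎
      where
      open ≡-Reasoning
      open Retrieved retrieved
      not-bit : ∀ b → not (bit b ≡ᵇ 0) ≡ b
      not-bit true  = refl
      not-bit false = refl

    readPred-yields : ∀ (s₁ : Store k) j W → (∀ a js → s₁ pred[ a ] js ≡ s pred[ a ] js) →
      Yields (readPred j W) s₁ (predWords s j W)
    readPred-yields s₁ j W kept = subst (Yields (readPred j W) s₁) (tabulate-cong λ a → kept a (j ∷ toList W))
      (readPredFrom-yields n l ω 0 1 j W s₁ k (λ i → i))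

    Optimum : Vec ℕ k → Set
    Optimum = Search.Maximum s n (λ W → InBox ω W × 𝓕 {ω = ω} G l n (decode W))

    optimum⇒returns : ∀ {W} s′ → Optimum W → result k n s′ ≡ R n (decode W) → Returns G l w (result k n s′)
    optimum⇒returns {W} s′ ((W≤ , W∈) , max) eq = tables , decode W , (W∈ , λ V V∈ →
      let V≡ = decode-encode V (proj₁ (proj₂ V∈)) in
      subst (λ U → s MIS (n ∷ toList (encode V)) ≤ s MIS (n ∷ toList U)) (sym (encode-decode W≤))
        (max (encode V) (encode-InBox V , subst (𝓕 G l n) (sym V≡) V∈))) , eq

    retrieval-ends : 0 < n → Ends retrieval s (λ _ s′ → Returns G l w (result k n s′))
    retrieval-ends 0<n = bind-ends (ends-mono
      (λ { (found ∷ best ∷ W*) s₁ (frame , seen , _) →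
        let zeros = replicate k 0
            -- The zero window lies in every `𝓕`, so the final search finds a window.
            zeros-candidate = zeros-InBox ω , subst (𝓕 G l n) (sym decode-zeros) (𝟎∈𝓕 G l n)
            s₁≡s , _ , optimum@((W*≤ , W*∈) , _) = best-maximum frame (λ V cand → seen V (proj₁ cand)) zeros zeros-candidate
        in bind-ends (ends-mono
          (λ _ s₂ (new , other) → sub-ends (ends-mono
            (λ { W s₃ (j , retrieved) → optimum⇒returns s₃ optimum (retrieved-result (subst (λ x → Retrieved W* (n ∸ 1) x W s₃) (last-level j retrieved) retrieved)) })
            -- The level equation determines `j` from `i`; the existential keeps truncated
            -- subtraction out of the invariant.
            (for-ends (λ i W s′ → Σ[ j ∈ ℕ ] Retrieved W* i j W s′)
              (n ∸ 1 , retrieved-start (m+[n∸m]≡n 0<n) W*≤ W*∈ new (λ y js ne → trans (other y js ne) (cong (λ x → x y js) s₁≡s)))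
              step)))
          (writeColumn-ends s₁ n W*)) })
      (forWindows-ends (λ W → W) Best Seen
        (λ { W W≤ ys@(_ ∷ _ ∷ _) s₁ best@(refl , _) → if𝓕-ends n W loaded ≤-refl W≤
          (λ W∈ → improve-ends best (W≤ , W∈)) (λ W∉ → skip best (λ cand → W∉ (proj₂ cand))) })
        none-best))
      where
      open Search s n (λ W → InBox ω W × 𝓕 {ω = ω} G l n (decode W)) hiding (value)
      last-level : ∀ {W₀ W s′} j → Retrieved W₀ (n ∸ 1) j W s′ → j ≡ 0
      last-level j retrieved = +-cancelˡ-≡ (suc (n ∸ 1)) j 0 (begin
        suc (n ∸ 1) + j   ≡⟨ +-suc (n ∸ 1) j ⟨
        n ∸ 1 + suc j     ≡⟨ Retrieved.level retrieved ⟩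
        n                 ≡⟨ m+[n∸m]≡n 0<n ⟨
        suc (n ∸ 1)       ≡⟨ +-identityʳ _ ⟨
        suc (n ∸ 1) + 0   ∎)
        where open ≡-Reasoning
      step : ∀ {W₀} i → i < n ∸ 1 → ∀ W s₁ → Σ[ j ∈ ℕ ] Retrieved W₀ i j W s₁ →
        Ends (sub n i λ j → bind (readPred j W) λ W′ → sub j 1 λ j′ → bind (writeColumn j′ W′) λ _ → ret W′) s₁
          (λ W′ s′ → Σ[ j ∈ ℕ ] Retrieved W₀ (suc i) j W′ s′)
      step i i<n-1 W s₁ (zero , retrieved) = contradiction i<n-1 (λ lt → <-irrefl refl (begin-strict
        i + 1         ≡⟨ +-comm i 1 ⟩
        suc i         <⟨ s≤s lt ⟩
        suc (n ∸ 1)   ≡⟨ m+[n∸m]≡n 0<n ⟩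
        n             ≡⟨ Retrieved.level retrieved ⟨
        i + 1         ∎))
        where open ≤-Reasoning
      -- The program recomputes the time of `W` as `n ∸ i`; the level equation turns this into
      -- `suc (suc j)`.
      step {W₀} i i<n-1 W s₁ (suc j , retrieved) = sub-ends (subst
        (λ x → Ends (bind (readPred x W) λ W′ → sub x 1 λ j′ → bind (writeColumn j′ W′) λ _ → ret W′) s₁ (λ W′ s′ → Σ[ j ∈ ℕ ] Retrieved W₀ (suc i) j W′ s′))
        (trans (sym (m+n∸m≡n i (suc (suc j)))) (cong (_∸ i) (Retrieved.level retrieved)))
        (bind-yields (readPred-yields s₁ (suc (suc j)) W (Retrieved.kept retrieved))
          (sub-ends (bind-ends (ends-mono
            (λ _ s′ (new , other) → ret-ends (j , retrieved-step retrieved new other))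
            (writeColumn-ends s₁ (suc j) (predWords s (suc (suc j)) W)))))))

  algorithm1-ends : ∀ {s} → 0 < n → Loaded G ω s → Ends (algorithm1 k n l ω) s (λ _ s′ → Returns G l w (result k n s′))
  algorithm1-ends 0<n loaded = lit-ends (lit-ends (bind-ends (ends-mono
    (λ _ _ (loaded′ , base , zeroed) → bind-ends (ends-mono (λ _ _ fw → retrieval-ends fw 0<n) (forward-ends loaded′ base zeroed)))
    (initialise-ends loaded))))

-- Step counts

-- Uniform in the store, so that the bound of a continuation applies whatever has been written
-- before it.
record Within {k r} (t : ℕ) (p : Prog ℕ k r) : Set where
  constructor within
  field bound : ∀ s → steps (run p s) ≤ t

open Within

private
  variable
    t u : ℕ

within-mono : {p : Prog ℕ k r} → t ≤ u → Within t p → Within u p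
within-mono t≤u (within h) = within λ s → ≤-trans (h s) t≤u

ret-within : {xs : Vec ℕ r} → Within {k} (suc r) (ret xs)
ret-within = within λ s → ≤-refl

bind-within : {p : Prog ℕ k q} {c : Vec ℕ q → Prog ℕ k r} → Within t p → (∀ xs → Within u (c xs)) → Within (suc t + u) (bind p c)
bind-within {p = p} hp hc = within λ s → +-mono-≤ (s≤s (bound hp s)) (bound (hc (words (run p s))) (store (run p s)))

lit-within : ∀ {m} {c : ℕ → Prog ℕ k r} → Within t (c m) → Within (suc t) (lit m c)
lit-within h = within λ s → s≤s (bound h s)

add-within : ∀ {x y} {c : ℕ → Prog ℕ k r} → Within t (c (x + y)) → Within (suc t) (add x y c)
add-within h = within λ s → s≤s (bound h s)

sub-within : ∀ {x y} {c : ℕ → Prog ℕ k r} → Within t (c (x ∸ y)) → Within (suc t) (sub x y c)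
sub-within h = within λ s → s≤s (bound h s)

read-within : ∀ {x is} {c : ℕ → Prog ℕ k r} → length is ≤ u → (∀ v → Within t (c v)) → Within (suc u + t) (read x is c)
read-within len h = within λ s → +-mono-≤ (s≤s len) (bound (h _) s)

write-within : ∀ {x is v} {p : Prog ℕ k r} → length is ≤ u → Within t p → Within (suc u + t) (write x is v p)
write-within len h = within λ s → +-mono-≤ (s≤s len) (bound h _)

private
  branch-steps : ∀ b {o o′ : Outcome k r} → steps o ≤ t → steps o′ ≤ u → steps (if b then o else o′) ≤ t ⊔ u
  branch-steps {t = t} {u} true  h _ = ≤-trans h (m≤m⊔n t u)
  branch-steps {t = t} {u} false _ h = ≤-trans h (m≤n⊔m t u)

if≡-within : ∀ {x y} {p p′ : Prog ℕ k r} → Within t p → Within u p′ → Within (suc (t ⊔ u)) (if≡ x y p p′)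
if≡-within {x = x} {y} h h′ = within λ s → s≤s (branch-steps (x ≡ᵇ y) (bound h s) (bound h′ s))

if≤-within : ∀ {x y} {p p′ : Prog ℕ k r} → Within t p → Within u p′ → Within (suc (t ⊔ u)) (if≤ x y p p′)
if≤-within {x = x} {y} h h′ = within λ s → s≤s (branch-steps (x ≤ᵇ y) (bound h s) (bound h′ s))

for-within : ∀ {b} {xs : Vec ℕ q} {body : ℕ → Vec ℕ q → Prog ℕ k q} → (∀ i ys → Within t (body i ys)) →
  Within (1 + b * suc t) (for b xs body)
for-within {t = t} {b} h = within λ s → iterate-invariant (λ i o → steps o ≤ 1 + i * suc t) b
  (λ i _ o le → ≤-trans (+-mono-≤ (s≤s le) (bound (h i (words o)) (store o))) (≤-reflexive (rearrange i)))
  ≤-refl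
  where
  rearrange : ∀ i → suc (1 + i * suc t) + t ≡ 1 + suc i * suc t
  rearrange i = cong suc (trans (cong suc (+-comm (i * suc t) t)) refl)

foldr-within : ∀ {A : Set} {F : A → Prog ℕ k r → Prog ℕ k r} {p} (f : ℕ → ℕ) →
  (∀ i {t} {next} → Within t next → Within (f t) (F i next)) → Within t p →
  ∀ xs → Within (foldr (λ _ → f) t xs) (foldr F p xs)
foldr-within f step h []       = h
foldr-within f step h (i ∷ xs) = step i (foldr-within f step h xs)

readPredFrom-steps : ℕ → ℕ → ℕ
readPredFrom-steps k zero    = 1
readPredFrom-steps k (suc m) = suc (suc k) + (suc (readPredFrom-steps k m) + suc (suc m))

readPredFrom-within : ∀ {k} (n l ω z o j : ℕ) (W : Vec ℕ k) m (f : Fin m → Fin k) →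
  Within (readPredFrom-steps k m) (readPredFrom n l ω z o j W f)
readPredFrom-within n l ω z o j W zero    f = ret-within
readPredFrom-within n l ω z o j W (suc m) f = read-within (s≤s (≤-reflexive (length-toList W)))
  λ _ → bind-within (readPredFrom-within n l ω z o j W m (λ i → f (suc i))) λ _ → ret-within

before-steps : ℕ → ℕ
before-steps zero    = 1
before-steps (suc m) = suc (before-steps m) + suc (suc (suc m) ⊔ suc (suc (suc m) ⊔ suc (suc (suc m))))

-- Since `1 ≤ E`, the overhead of an iteration is at most `E` times itself. The 2 pays for starting
-- the loop and for the step charged per iteration.
loop-bound : ∀ {n E} a d → 1 ≤ n → 1 ≤ E → 1 + n * suc (a + E * d) ≤ (2 + a + d) * (n * E)
loop-bound {n} {E} a d 1≤n 1≤E = begin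
  1 + n * suc (a + E * d)            ≤⟨ +-mono-≤ (*-mono-≤ 1≤n 1≤E) (*-monoʳ-≤ n (+-monoˡ-≤ (E * d) (m≤n*m (suc a) E {{>-nonZero 1≤E}}))) ⟩
  n * E + n * (E * suc a + E * d)    ≡⟨ cong (λ x → n * E + n * x) (*-distribˡ-+ E (suc a) d) ⟨
  n * E + n * (E * (suc a + d))      ≡⟨ cong (λ x → n * E + x) (*-assoc n E (suc a + d)) ⟨
  n * E + n * E * (suc a + d)        ≡⟨ cong (λ x → n * E + x) (*-comm (n * E) (suc a + d)) ⟩
  (2 + a + d) * (n * E)              ∎
  where open ≤-Reasoning

-- Keeps the factor apart from the size. As a parameter of a record it can be inferred, whereas it
-- could not be recovered from the product `c * M`.
record WithinMultiple {k r} (M c : ℕ) (p : Prog ℕ k r) : Set where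
  constructor multiple
  field unmultiple : Within (c * M) p

open WithinMultiple

private
  variable
    M c d : ℕ

const-multiple : {p : Prog ℕ k r} → 1 ≤ M → Within c p → WithinMultiple M c p
const-multiple {M = M} {c} 1≤M h = multiple (within-mono (m≤m*n c M {{>-nonZero 1≤M}}) h)

bind-multiple : {p : Prog ℕ k q} {f : Vec ℕ q → Prog ℕ k r} → 1 ≤ M →
  WithinMultiple M c p → (∀ xs → WithinMultiple M d (f xs)) → WithinMultiple M (1 + c + d) (bind p f)
bind-multiple {M = M} {c} {d} 1≤M hp hf = multiple (within-mono
  (≤-trans (+-monoˡ-≤ (d * M) (+-monoˡ-≤ (c * M) 1≤M)) (≤-reflexive (sym (*-distribʳ-+ M (suc c) d))))
  (bind-within (unmultiple hp) λ xs → unmultiple (hf xs)))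

sub-multiple : ∀ {x y} {f : ℕ → Prog ℕ k r} → 1 ≤ M → WithinMultiple M c (f (x ∸ y)) → WithinMultiple M (1 + c) (sub x y f)
sub-multiple {M = M} {c} 1≤M h = multiple (within-mono (+-monoˡ-≤ (c * M) 1≤M) (sub-within (unmultiple h)))

lit-multiple : ∀ {m} {f : ℕ → Prog ℕ k r} → 1 ≤ M → WithinMultiple M c (f m) → WithinMultiple M (1 + c) (lit m f)
lit-multiple {M = M} {c} 1≤M h = multiple (within-mono (+-monoˡ-≤ (c * M) 1≤M) (lit-within (unmultiple h)))

write-multiple : ∀ {x is v} {p : Prog ℕ k r} → 1 ≤ M → WithinMultiple M c p → WithinMultiple M (suc (length is) + c) (write x is v p)
write-multiple {M = M} {c} {is = is} 1≤M h = multiple (within-mono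
  (≤-trans (+-monoˡ-≤ (c * M) (m≤m*n (suc (length is)) M {{>-nonZero 1≤M}})) (≤-reflexive (sym (*-distribʳ-+ M (suc (length is)) c))))
  (write-within ≤-refl (unmultiple h)))

module Steps (k : ℕ) where

  index-length : ∀ (j : ℕ) (W : Vec ℕ k) → length (j ∷ toList W) ≤ suc k
  index-length j W = s≤s (≤-reflexive (length-toList W))

  M≥1 : ∀ n ω → 1 ≤ n → 1 ≤ n * (ω + 1) ^ k
  M≥1 n ω 1≤n = *-mono-≤ 1≤n (m^n>0 (ω + 1) {{>-nonZero (m≤n+m 1 ω)}} k)

  module _ (n l ω : ℕ) where
    open Program {ℕ} {k} n l ω 0 1

    -- Each of the `m` levels costs one step to start and one per iteration, which is at most 2 for
    -- each run of the innermost body because `1 ≤ b`.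
    forVec-within : ∀ {q t} m b {xs : Vec ℕ q} {body} → 1 ≤ b → (∀ ps ys → Within t (body ps ys)) →
      Within (b ^ m * (t + 2 * m)) (forVec m b xs body)
    forVec-within {t = t} zero    b {xs} 1≤b h = within-mono (≤-reflexive (sym (trans (+-identityʳ (t + 0)) (+-identityʳ t)))) (h [] xs)
    forVec-within {t = t} (suc m) b 1≤b h = within-mono arith (for-within λ p ys → forVec-within m b 1≤b (λ ps → h (p ∷ ps)))
      where
      open ≤-Reasoning
      arith : 1 + b * suc (b ^ m * (t + 2 * m)) ≤ b ^ suc m * (t + 2 * suc m)
      arith = begin
        1 + b * suc (b ^ m * (t + 2 * m))       ≤⟨ +-monoˡ-≤ _ 1≤b ⟩
        b + b * suc (b ^ m * (t + 2 * m))       ≡⟨ *-suc b (suc (b ^ m * (t + 2 * m))) ⟨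
        b * (2 + b ^ m * (t + 2 * m))           ≤⟨ *-monoʳ-≤ b (+-monoˡ-≤ _ (m≤n*m 2 (b ^ m) {{m^n≢0 b m {{>-nonZero 1≤b}}}})) ⟩
        b * (b ^ m * 2 + b ^ m * (t + 2 * m))   ≡⟨ cong (b *_) (*-distribˡ-+ (b ^ m) 2 (t + 2 * m)) ⟨
        b * (b ^ m * (2 + (t + 2 * m)))         ≡⟨ *-assoc b (b ^ m) _ ⟨
        b ^ suc m * (2 + (t + 2 * m))           ≡⟨ cong (b ^ suc m *_) (solve 2 (λ x y → con 2 :+ (x :+ con 2 :* y) := x :+ con 2 :* (con 1 :+ y)) refl t m) ⟩
        b ^ suc m * (t + 2 * suc m)             ∎
        where open ℕ.+-*-Solver

    forWindows-within : ∀ {q t} {xs : Vec ℕ q} {body} → (∀ W ys → Within t (body W ys)) →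
      Within (1 + (ω + 1) ^ k * (t + 2 * k)) (forWindows xs body)
    forWindows-within h = add-within (forVec-within k (ω + 1) (m≤n+m 1 ω) h)

    before-within : ∀ {m} (ps bs : Vec ℕ m) → Within (before-steps m) (before ps bs)
    before-within []       []       = ret-within
    before-within (p ∷ ps) (b ∷ bs) = bind-within (before-within ps bs) λ _ →
      if≡-within ret-within (if≡-within ret-within (add-within ret-within))

  private
    sum-steps : ℕ → ℕ
    sum-steps c = foldr (λ _ t → suc t + (suc c + 3)) 2 (allFin k)

  sumRows-within : ∀ {n l ω c} {f : Fin k → Prog ℕ k 1} → (∀ i → Within c (f i)) → Within (sum-steps c) (Program.sumRows n l ω 0 1 f)
  sumRows-within h = foldr-within _
    (λ i rest → bind-within rest λ { (_ ∷ []) → bind-within (h i) λ { (_ ∷ []) → add-within ret-within } })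
    ret-within (allFin k)

  -- The bound comes before the quantifiers over `n`, `l`, `ω` and `W`, so what unification finds
  -- depends on `k` and `t` only. The other step counts below follow this pattern.
  feasible-steps : Σ[ f ∈ (ℕ → ℕ) ] (∀ n l ω {r t} W {accept reject : Prog ℕ k r} → Within t accept → Within t reject →
    Within (f t) (Program.ifFeasible n l ω 0 1 W accept reject))
  feasible-steps = (λ t → _) , λ n l ω W acc rej → foldr-within _
    (λ i next → if≡-within next (bind-within (sumRows-within {n} {l} {ω} λ _ → if≡-within ret-within ret-within) λ { (_ ∷ []) → if≤-within next rej }))
    acc (allFin k)

  𝓕-steps : Σ[ f ∈ (ℕ → ℕ) ] (∀ n l ω {r t} j W {accept reject : Prog ℕ k r} → Within t accept → Within t reject →
    Within (f t) (Program.if𝓕 n l ω 0 1 j W accept reject))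
  𝓕-steps = (λ t → _) , λ n l ω j W acc rej → foldr-within _
    (λ i next → if≡-within next (add-within (read-within ≤-refl λ _ → if≡-within rej next)))
    (proj₂ feasible-steps n l ω W acc rej) (allFin k)

  inner-steps : Σ[ c ∈ ℕ ] (∀ n l ω j (W : Vec ℕ k) → Within c (Program.inner n l ω 0 1 j W))
  inner-steps = _ , λ n l ω j W → sumRows-within {n} {l} {ω} λ i →
    if≡-within (add-within (read-within ≤-refl λ _ → ret-within)) ret-within

  improve-steps : Σ[ c ∈ ℕ ] (∀ n l ω j (W : Vec ℕ k) ys → Within c (Program.improve n l ω 0 1 j W ys))
  improve-steps = _ , λ { n l ω j W (_ ∷ _ ∷ _) →
    read-within (index-length j W) λ _ → if≡-within ret-within (if≤-within ret-within ret-within) }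

  writeColumn-steps : Σ[ c ∈ ℕ ] (∀ n l ω j (W : Vec ℕ k) → Within c (Program.writeColumn n l ω 0 1 j W))
  writeColumn-steps = _ , λ n l ω j W → foldr-within _
    (λ i next → if≡-within (write-within ≤-refl next) (write-within ≤-refl next)) ret-within (allFin k)

  -- `3 + k` is the cost of returning the `2 + k` words of the running maximum unchanged.
  search-steps : ℕ
  search-steps = proj₁ 𝓕-steps (proj₁ improve-steps ⊔ (3 + k))

  search-within : ∀ n l ω j (W : Vec ℕ k) ys → Within search-steps
    (Program.if𝓕 n l ω 0 1 j W (Program.improve n l ω 0 1 j W ys) (ret ys))
  search-within n l ω j W ys = proj₂ 𝓕-steps n l ω j W
    (within-mono (m≤m⊔n (proj₁ improve-steps) (3 + k)) (proj₂ improve-steps n l ω j W ys)) (within-mono (m≤n⊔m (proj₁ improve-steps) (3 + k)) ret-within)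

  choose-steps : Σ[ c ∈ ℕ ] (∀ n l ω i (W : Vec ℕ k) → let open Program {ℕ} {k} n l ω 0 1 in Within c
    (forVec k 2 none λ bs best → bind (before W bs) λ W* → if𝓕 i W* (improve i W* best) (ret best)))
  choose-steps = _ , λ n l ω i W → forVec-within n l ω k 2 (s≤s z≤n) λ bs ys →
    bind-within (before-within n l ω W bs) λ W* → search-within n l ω i W* ys

  -- The 4 is that of `loop-bound` with `a = 2`: one addition computes the time, another the bound
  -- `ω + 1` of the loops over windows.
  pass-within : ∀ n l ω {t} {body : ℕ → Vec ℕ 0 → ℕ → Vec ℕ k → Vec ℕ 0 → Prog ℕ k 0} → 1 ≤ n → (∀ i xs j W ys → Within t (body i xs j W ys)) →
    WithinMultiple (n * (ω + 1) ^ k) (4 + (t + 2 * k)) (for n [] λ i xs → add i 1 λ j → Program.forWindows n l ω 0 1 [] (body i xs j))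
  pass-within n l ω {t} 1≤n h = multiple (within-mono (loop-bound 2 (t + 2 * k) 1≤n (m^n>0 (ω + 1) {{>-nonZero (m≤n+m 1 ω)}} k))
    (for-within λ i xs → add-within (forWindows-within n l ω (h i xs (i + 1)))))

  initialise-steps : Σ[ c ∈ ℕ ] (∀ n l ω → 1 ≤ n → WithinMultiple (n * (ω + 1) ^ k) c (Program.initialise {k = k} n l ω 0 1))
  initialise-steps = _ , λ n l ω 1≤n → write-multiple (M≥1 n ω 1≤n) (pass-within n l ω 1≤n λ i _ j W _ →
    proj₂ feasible-steps n l ω W (write-within (index-length j W) ret-within) (within-mono (s≤s z≤n) ret-within))

  forward-steps : Σ[ c ∈ ℕ ] (∀ n l ω → 1 ≤ n → WithinMultiple (n * (ω + 1) ^ k) c (Program.forward {k = k} n l ω 0 1))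
  forward-steps = _ , λ n l ω 1≤n → pass-within n l ω 1≤n λ i _ j W _ → proj₂ 𝓕-steps n l ω j W
    (bind-within (add-within (proj₂ choose-steps n l ω i W)) λ { (_ ∷ v ∷ W*) →
      bind-within (proj₂ inner-steps n l ω j W) λ { (g ∷ []) → add-within (write-within (index-length j W)
        (foldr-within _ (λ a → write-within (index-length j W)) ret-within (allFin k))) } })
    (within-mono (s≤s z≤n) ret-within)

  back-steps : Σ[ c ∈ ℕ ] (∀ n l ω i (W : Vec ℕ k) → let open Program {ℕ} {k} n l ω 0 1 in Within c
    (sub n i λ j → bind (readPred j W) λ W′ → sub j 1 λ j′ → bind (writeColumn j′ W′) λ _ → ret W′))
  back-steps = _ , λ n l ω i W → sub-within (bind-within (readPredFrom-within n l ω 0 1 (n ∸ i) W k (λ i → i)) λ W′ →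
    sub-within (bind-within (proj₂ writeColumn-steps n l ω (n ∸ i ∸ 1) W′) λ _ → ret-within))

  retrieval-steps : Σ[ c ∈ ℕ ] (∀ n l ω → 1 ≤ n → WithinMultiple (n * (ω + 1) ^ k) c (Program.retrieval {k = k} n l ω 0 1))
  retrieval-steps = _ , λ n l ω 1≤n → bind-multiple (M≥1 n ω 1≤n) (first n l ω 1≤n) λ { (_ ∷ _ ∷ W*) →
    bind-multiple (M≥1 n ω 1≤n) (const-multiple (M≥1 n ω 1≤n) (proj₂ writeColumn-steps n l ω n W*)) λ _ →
    sub-multiple (M≥1 n ω 1≤n) (back n l ω 1≤n) }
    where
    first : ∀ n l ω → 1 ≤ n → WithinMultiple (n * (ω + 1) ^ k) (1 + (search-steps + 2 * k)) (Program.forWindows n l ω 0 1 (Program.none n l ω 0 1)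
      λ W best → Program.if𝓕 n l ω 0 1 n W (Program.improve n l ω 0 1 n W best) (ret best))
    first n l ω 1≤n = multiple (within-mono (+-mono-≤ (M≥1 n ω 1≤n)
      (≤-trans (≤-reflexive (*-comm ((ω + 1) ^ k) (search-steps + 2 * k)))
        (*-monoʳ-≤ (search-steps + 2 * k) (m≤n*m ((ω + 1) ^ k) n {{>-nonZero 1≤n}}))))
      (forWindows-within n l ω λ W ys → search-within n l ω n W ys))
    back : ∀ n l ω → 1 ≤ n → ∀ {W*} → WithinMultiple (n * (ω + 1) ^ k) (2 + proj₁ back-steps + 0) (for (n ∸ 1) W* λ i W → _)
    -- An iteration of the traceback has constant cost; `d = 0` fits it into the multiple common to
    -- all phases.
    back n l ω 1≤n = multiple (within-mono (≤-trans (s≤s (*-mono-≤ (m∸n≤m n 1) (s≤s (m≤m+n (proj₁ back-steps) ((ω + 1) ^ k * 0)))))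
        (loop-bound (proj₁ back-steps) 0 1≤n (m^n>0 (ω + 1) {{>-nonZero (m≤n+m 1 ω)}} k)))
      (for-within λ i W → proj₂ back-steps n l ω i W))

  algorithm1-steps : Σ[ c ∈ ℕ ] (∀ n l ω → 1 ≤ n → WithinMultiple (n * (ω + 1) ^ k) c (algorithm1 k n l ω))
  algorithm1-steps = _ , λ n l ω 1≤n → let 1≤M = M≥1 n ω 1≤n in lit-multiple 1≤M (lit-multiple 1≤M
    (bind-multiple 1≤M (proj₂ initialise-steps n l ω 1≤n) λ _ →
     bind-multiple 1≤M (proj₂ forward-steps n l ω 1≤n) λ _ → proj₂ retrieval-steps n l ω 1≤n))

^-distrib-* : ∀ m n o → (m * n) ^ o ≡ m ^ o * n ^ o
^-distrib-* m n zero    = refl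
^-distrib-* m n (suc o) = trans (cong (m * n *_) (^-distrib-* m n o)) ([m*n]*[o*p]≡[m*o]*[n*p] m n (m ^ o) (n ^ o))

-- `ω = suc w` is positive, so `ω + 1 ≤ 2 * ω`; and `k ≥ 1` gives `1 ≤ k ^ l`, which brings in the
-- factor `k ^ l`.
windows-bound : ∀ k l n w .{{_ : NonZero k}} → n * (suc w + 1) ^ k ≤ 2 ^ k * (n * k ^ l * suc w ^ k)
windows-bound k l n w = begin
  n * (suc w + 1) ^ k              ≤⟨ *-monoʳ-≤ n (^-monoˡ-≤ k (+-monoʳ-≤ (suc w) (≤-trans (s≤s z≤n) (m≤m+n (suc w) 0)))) ⟩
  n * (2 * suc w) ^ k              ≡⟨ cong (n *_) (^-distrib-* 2 (suc w) k) ⟩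
  n * (2 ^ k * suc w ^ k)          ≡⟨ *-assoc n (2 ^ k) (suc w ^ k) ⟨
  n * 2 ^ k * suc w ^ k            ≡⟨ cong (_* suc w ^ k) (*-comm n (2 ^ k)) ⟩
  2 ^ k * n * suc w ^ k            ≡⟨ *-assoc (2 ^ k) n (suc w ^ k) ⟩
  2 ^ k * (n * suc w ^ k)          ≤⟨ *-monoʳ-≤ (2 ^ k) (*-monoˡ-≤ (suc w ^ k) (m≤m*n n (k ^ l) {{m^n≢0 k l}})) ⟩
  2 ^ k * (n * k ^ l * suc w ^ k)  ∎
  where open ≤-Reasoning

theorem2 : (k : ℕ) → .{{_ : NonZero k}} →
    ((n l ω-1 : ℕ) → .{{_ : NonZero n}} → (G : Array k n) →
    (I : Array k n) → Returns G l ω-1 I → Optimal G l (suc ω-1) I)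
    ×
    (Σ[ C ∈ ℕ ]
    ((n l ω-1 : ℕ) → .{{_ : NonZero n}} → (G : Array k n) →
    (s : Store k) → Loaded G (suc ω-1) s →
    let final = run (algorithm1 k n l (suc ω-1)) s in
    Returns G l ω-1 (result k n (Outcome.store final))
    × Outcome.steps final ≤ C * (n * k ^ l * suc ω-1 ^ k)))
theorem2 k =
  (λ n l w G → returns⇒optimal G l w) ,
  -- `factor` bounds the steps per time point and vector of words; `2 ^ k` is the price of replacing
  -- `ω + 1` by `ω`.
  factor * 2 ^ k , λ n l w G s loaded →
    Ends.holds (Run.algorithm1-ends G l w (>-nonZero⁻¹ n) loaded) ,
    (begin
      steps (run (algorithm1 k n l (suc w)) s)  ≤⟨ bound (unmultiple (proj₂ (Steps.algorithm1-steps k) n l (suc w) (>-nonZero⁻¹ n))) s ⟩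
      factor * (n * (suc w + 1) ^ k)                 ≤⟨ *-monoʳ-≤ factor (windows-bound k l n w) ⟩
      factor * (2 ^ k * (n * k ^ l * suc w ^ k))     ≡⟨ *-assoc factor (2 ^ k) _ ⟨
      factor * 2 ^ k * (n * k ^ l * suc w ^ k)       ∎)
  where
  open ≤-Reasoning
  factor : ℕ
  factor = proj₁ (Steps.algorithm1-steps k)
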